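{- The generating function of ascending polyominoes counted by semi-perimeter, $A(t)=\sum_{P}t^{|P|}$ (sum over all ascending polyominoes $P$, $|P|$ the semi-perimeter), is \[A(t)=\frac{t^2(2-12t+19t^2-4t^3)}{2(1-4t)^2}-\frac{t^4(5-8t)}{2(1-2t)(1-4t)^{3/2}}.\]
   Context: A polyomino is a finite edge-connected set of unit cells; it is convex if every row and column is a contiguous segment; its semi-perimeter is the width plus the height of its minimal bounding rectangle. A NW-path inside $P$ is a sequence of cells of $P$, consecutive cells sharing an edge, each step North or West; write $a\nwarrow b$ if such a path exists, let $D_{NW}(a,b)$ be the minimum number of direction changes over such paths, and $D_{NW}(P)=\max\{D_{NW}(a,b):a\nwarrow b\}$. A convex polyomino is ascending if $D_{NW}(P)\le1$. -}

module Defs where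

open import Data.Nat using (ℕ; zero; suc; _+_; _∸_; _<_; _≤_)
open import Data.Integer using (ℤ; +_; -[1+_])
open import Data.Rational using (ℚ; _/_; 0ℚ; 1ℚ) renaming (_+_ to _+q_; _*_ to _*q_; _-_ to _-q_)
open import Data.Bool using (Bool; true)
open import Data.Vec using (Vec; lookup)
open import Data.Fin using (fromℕ<)
open import Data.Product using (Σ; _×_; _,_; ∃)
open import Data.List using (List; []; _∷_; length)
open import Data.List.Membership.Propositional using (_∈_)
open import Data.List.Relation.Unary.Unique.Propositional using (Unique)
open import Relation.Binary.PropositionalEquality using (_≡_)
open import Function.Bundles using (_⇔_)

-- Polyominoes, normalised up to translation.
-- A cell is (x , y) : ℕ × ℕ, x = column (East = increasing x),
-- y = row (North = increasing y).  A grid of width w and height h is a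
-- w × h Boolean array; lookup (lookup v x) y = true means cell (x,y) is in.

Cell : Set
Cell = ℕ × ℕ

Grid : Set
Grid = Σ ℕ λ w → Σ ℕ λ h → Vec (Vec Bool h) w

width : Grid → ℕ
width (w , _ , _) = w

height : Grid → ℕ
height (_ , h , _) = h

In : Grid → Cell → Set
In (w , h , v) (x , y) =
  Σ (x < w) λ p → Σ (y < h) λ q → lookup (lookup v (fromℕ< p)) (fromℕ< q) ≡ true

-- the cell set exactly fills its minimal bounding rectangle [0,w) × [0,h):
-- some cell in column 0, in column w-1, in row 0, in row h-1
-- (this also forces non-emptiness, hence w ≥ 1 and h ≥ 1)
Tight : Grid → Set
Tight g@(w , h , _) =
  (Σ ℕ λ y → In g (0 , y)) × (Σ ℕ λ y → In g (w ∸ 1 , y)) ×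
  (Σ ℕ λ x → In g (x , 0)) × (Σ ℕ λ x → In g (x , h ∸ 1))

data Adj : Cell → Cell → Set where
  east  : ∀ {x y} → Adj (x , y) (suc x , y)
  west  : ∀ {x y} → Adj (suc x , y) (x , y)
  north : ∀ {x y} → Adj (x , y) (x , suc y)
  south : ∀ {x y} → Adj (x , suc y) (x , y)

data Reach (g : Grid) : Cell → Cell → Set where
  here : ∀ {a} → In g a → Reach g a a
  step : ∀ {a c b} → In g a → Adj a c → Reach g c b → Reach g a b

Connected : Grid → Set
Connected g = ∀ a b → In g a → In g b → Reach g a b

Convex : Grid → Set
Convex g =
  (∀ x₁ x x₂ y → In g (x₁ , y) → In g (x₂ , y) → x₁ ≤ x → x ≤ x₂ → In g (x , y)) ×
  (∀ x y₁ y y₂ → In g (x , y₁) → In g (x , y₂) → y₁ ≤ y → y ≤ y₂ → In g (x , y))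

data Dir : Set where
  N W : Dir

data NWPath (g : Grid) : Cell → List Dir → Cell → Set where
  done  : ∀ {a} → In g a → NWPath g a [] a
  stepN : ∀ {x y ds b} → In g (x , y) → NWPath g (x , suc y) ds b →
          NWPath g (x , y) (N ∷ ds) b
  stepW : ∀ {x y ds b} → In g (suc x , y) → NWPath g (x , y) ds b →
          NWPath g (suc x , y) (W ∷ ds) b

sameDir : Dir → Dir → ℕ
sameDir N N = 0
sameDir W W = 0
sameDir N W = 1
sameDir W N = 1

changes : List Dir → ℕ
changes [] = 0
changes (d ∷ []) = 0
changes (d ∷ e ∷ ds) = sameDir d e + changes (e ∷ ds)

-- D_NW(P) ≤ 1 : whenever a ↖ b, D_NW(a,b) ≤ 1, i.e. some NW-path from a to b
-- has at most one direction change
NWAtMostOne : Grid → Set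
NWAtMostOne g = ∀ a b ds → NWPath g a ds b →
  Σ (List Dir) λ es → NWPath g a es b × changes es ≤ 1

IsAscending : ℕ → Grid → Set
IsAscending n g =
  Tight g × Connected g × Convex g × NWAtMostOne g × width g + height g ≡ n

CountsAscending : (ℕ → ℕ) → Set
CountsAscending a = ∀ n → Σ (List Grid) λ L →
  Unique L × (∀ g → (g ∈ L) ⇔ IsAscending n g) × length L ≡ a n

Series : Set
Series = ℕ → ℚ

_≈ₛ_ : Series → Series → Set
f ≈ₛ g = ∀ n → f n ≡ g n
infix 4 _≈ₛ_

int : ℤ → ℚ
int i = i / 1

const : ℚ → Series
const q zero = q
const q (suc n) = 0ℚ

cst : ℤ → Series
cst i = const (int i)

X : Series
X (suc zero) = 1ℚ
X _ = 0ℚ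

_⊕_ : Series → Series → Series
(f ⊕ g) n = f n +q g n

_⊖_ : Series → Series → Series
(f ⊖ g) n = f n -q g n

sumTo : ℕ → (ℕ → ℚ) → ℚ
sumTo zero h = h 0
sumTo (suc n) h = sumTo n h +q h (suc n)

_⊗_ : Series → Series → Series
(f ⊗ g) n = sumTo n (λ k → f k *q g (n ∸ k))

infixl 6 _⊕_ _⊖_
infixl 7 _⊗_

_^ₛ_ : Series → ℕ → Series
f ^ₛ zero = const 1ℚ
f ^ₛ suc k = f ⊗ (f ^ₛ k)
infixr 8 _^ₛ_

fromCount : (ℕ → ℕ) → Series
fromCount a n = int (+ (a n))

{-# OPTIONS --safe #-}
-- Describe column x of an ascending polyomino by its interval [l x , u x] of rows.
-- Connectedness and convexity say that adjacent intervals meet, that u is unimodal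
-- and that l is a valley; D_NW ≤ 1 says that u x ≤ u y or l x ≤ l y whenever x < y.
-- Peel such a profile from the outside at increasing heights: remove the first column
-- if its upper end is the current height, else the last column if its upper end is the
-- current height, else raise the height.  Comparability of the columns makes a single
-- parameter suffice to say which columns may come next, namely the difference p between
-- an upper bound for the lower end of the last column and the lower end of the first.
-- Each unit of semi-perimeter is paid for by one step of the peeling, so the generating
-- functions satisfy a linear system indexed by p; it is solved by combinations of C ^ p,
-- where C = 1 + t C² and 1 - 2 t C = √(1 - 4t), and of the two series that describe
-- polyominoes with a monotone lower boundary.
module Submission where

-- One parameter suffices for the following reason. A column removed on the left has the least upper
-- end of those present, so it is comparable with all of them, and the next column only has to meet
-- it. A column removed on the right has a smaller upper end than the first; comparability puts the
-- first lower end at or below its own, and the valley condition extends this to all columns in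
-- between. Its lower end thus caps everything that follows and replaces the height as right-hand
-- bound. Comparability also provides the start: no upper end lies below the lower end of the first
-- column, so the peeling begins at that height, with p = 0. Both a growing height and a falling
-- lower end increase p, so the equations never close at finitely many p. The closed form is
-- therefore only verified: the differences between the series and the candidates obey recurrences
-- without inhomogeneous terms, and whatever these take from a larger p carries a factor t.

open import Defs

-- Peeling histories as an inductive family, and their enumeration.

module Codes where

  open import Data.Nat using (ℕ; zero; suc; _+_; _<_)
  open import Data.Nat.Properties
  open import Data.Fin using (Fin; zero; suc)
  open import Data.Fin.Properties using (0↔⊥; 1↔⊤; +↔⊎)
  open import Data.Product using (Σ; _×_; _,_)
  open import Data.Sum using (_⊎_; inj₁; inj₂)
  open import Data.Sum.Function.Propositional using (_⊎-↔_)
  open import Data.Empty using (⊥; ⊥-elim)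
  open import Data.Unit using (tt)
  open import Relation.Nullary using (¬_)
  open import Relation.Binary.PropositionalEquality using (_≡_; refl; cong)
  open import Function.Bundles using (_↔_; mk↔ₛ′)
  open import Function.Construct.Composition using (_↔-∘_)

  -- falling: the lower end of the first column may still go down; rising: lower ends are
  -- monotone from here on.  The right-hand bound is the current height (level) until some
  -- column has been removed on the right, and then the lower end of that column (fixed).
  data Phase : Set where
    falling rising : Phase

  data Bound : Set where
    level fixed : Bound

  raise : Bound → ℕ → ℕ
  raise level p = suc p
  raise fixed p = p

  -- A turn out of the falling phase must raise the lower end strictly, since an equal or smaller
  -- one is recorded by `left`; in the rising phase equality belongs to `turn` too. As the bound
  -- stays in place, this means x < p and x ≤ p respectively.
  turnRange : Phase → ℕ → ℕ
  turnRange falling p = p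
  turnRange rising  p = suc p

  -- A code is a history of the peeling; p is the right-hand bound minus the lower end of the
  -- first column, and n counts the remaining steps.  A turn leaves the lower end of the next
  -- column x below the bound; a drop lowers it one unit at a time.
  mutual
    data Code : Phase → Bound → ℕ → ℕ → Set where
      last : ∀ {φ β p} → Code φ β p 1
      left : ∀ {β p n} → Drop β p n → Code falling β p (suc n)
      turn : ∀ {φ β p n} x → x < turnRange φ p → Code rising β x n → Code φ β p (suc n)
      high : ∀ {φ β p n} → Code⁺ φ β p n → Code φ β p n

    -- Here the first column is higher than the current height. Since `right` starts and ends in
    -- this state, a column on the right goes only once the left has nothing to remove at that
    -- height, which makes the order of removal canonical.
    data Code⁺ : Phase → Bound → ℕ → ℕ → Set where
      up    : ∀ {φ β p n} → Code φ β (raise β p) n → Code⁺ φ β p (suc n)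
      right : ∀ {φ β p n} x → x < suc p → Code⁺ φ fixed x n → Code⁺ φ β p (suc n)

    data Drop : Bound → ℕ → ℕ → Set where
      stay : ∀ {β p n} → Code falling β p n → Drop β p n
      down : ∀ {β p n} → Drop β (suc p) n → Drop β p (suc n)

  sumBelow : ℕ → (ℕ → ℕ) → ℕ
  sumBelow zero    f = 0
  sumBelow (suc p) f = f p + sumBelow p f

  isZero : ℕ → ℕ
  isZero zero    = 1
  isZero (suc _) = 0

  #Code  : Phase → Bound → ℕ → ℕ → ℕ
  #Code⁺ : Phase → Bound → ℕ → ℕ → ℕ
  #Drop  : Bound → ℕ → ℕ → ℕ
  #Left  : Phase → Bound → ℕ → ℕ → ℕ

  #Code φ β p zero    = 0
  #Code φ β p (suc n) =
    -- `high` costs no step, so `#Code⁺` is taken at the same length; both of its own constructors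
    -- cost one, which makes the recursion well founded.
    isZero n + (#Left φ β p n + (sumBelow (turnRange φ p) (λ x → #Code rising β x n) + #Code⁺ φ β p (suc n)))

  #Code⁺ φ β p zero    = 0
  #Code⁺ φ β p (suc n) = #Code φ β (raise β p) n + sumBelow (suc p) (λ x → #Code⁺ φ fixed x n)

  #Drop β p zero    = 0
  #Drop β p (suc n) = #Code falling β p (suc n) + #Drop β (suc p) n

  #Left falling β p n = #Drop β p n
  #Left rising  β p n = 0

  Below : ℕ → (ℕ → Set) → Set
  Below p F = Σ ℕ λ x → x < p × F x

  below-zero : ∀ {F} → ⊥ ↔ Below 0 F
  below-zero = mk↔ₛ′ (λ ()) (λ { (_ , () , _) }) (λ { (_ , () , _) }) (λ ())

  below-suc : ∀ {p F} → (F p ⊎ Below p F) ↔ Below (suc p) F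
  below-suc {p} {F} = mk↔ₛ′ to from to∘from from∘to
    where
    to : F p ⊎ Below p F → Below (suc p) F
    to (inj₁ e)             = p , n<1+n p , e
    to (inj₂ (x , x<p , e)) = x , m<n⇒m<1+n x<p , e

    from′ : ∀ x → x < p ⊎ x ≡ p → F x → F p ⊎ Below p F
    from′ x (inj₁ x<p)  e = inj₂ (x , x<p , e)
    from′ x (inj₂ refl) e = inj₁ e

    from : Below (suc p) F → F p ⊎ Below p F
    from (x , x<1+p , e) = from′ x (m<1+n⇒m<n∨m≡n x<1+p) e

    to∘from′ : ∀ x s x<1+p e → to (from′ x s e) ≡ (x , x<1+p , e)
    to∘from′ x (inj₁ x<p)  q e = cong (λ r → x , r , e) (≤-irrelevant _ _)
    to∘from′ x (inj₂ refl) q e = cong (λ r → x , r , e) (≤-irrelevant _ _)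

    to∘from : ∀ y → to (from y) ≡ y
    to∘from (x , x<1+p , e) = to∘from′ x (m<1+n⇒m<n∨m≡n x<1+p) x<1+p e

    from∘to : ∀ y → from (to y) ≡ y
    from∘to (inj₁ e) with m<1+n⇒m<n∨m≡n (n<1+n p)
    ... | inj₁ p<p  = ⊥-elim (<-irrefl refl p<p)
    ... | inj₂ refl = refl
    from∘to (inj₂ (x , x<p , e)) with m<1+n⇒m<n∨m≡n (m<n⇒m<1+n x<p)
    ... | inj₁ q    = cong (λ r → inj₂ (x , r , e)) (≤-irrelevant _ _)
    ... | inj₂ refl = ⊥-elim (<-irrefl refl x<p)

  infixr 4 _⟫_
  _⟫_ : ∀ {A B C : Set} → A ↔ B → B ↔ C → A ↔ C
  f ⟫ g = g ↔-∘ f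

  finBelow : ∀ p {f F} → (∀ x → Fin (f x) ↔ F x) → Fin (sumBelow p f) ↔ Below p F
  finBelow zero    e = 0↔⊥ ⟫ below-zero
  finBelow (suc p) e = +↔⊎ ⟫ (e p ⊎-↔ finBelow p e) ⟫ below-suc

  Left : Phase → Bound → ℕ → ℕ → Set
  Left falling β p n = Drop β p n
  Left rising  β p n = ⊥

  code-unfold : ∀ {φ β p n} →
    (n ≡ 0 ⊎ Left φ β p n ⊎ Below (turnRange φ p) (λ x → Code rising β x n) ⊎ Code⁺ φ β p (suc n))
    ↔ Code φ β p (suc n)
  code-unfold {φ} {β} {p} {n} = mk↔ₛ′ to from to∘from (from∘to φ)
    where
    fromLeft : ∀ φ {n} → Left φ β p n → Code φ β p (suc n)
    fromLeft falling d = left d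

    to : ∀ {φ n} → n ≡ 0 ⊎ Left φ β p n ⊎ Below (turnRange φ p) (λ x → Code rising β x n) ⊎ Code⁺ φ β p (suc n)
       → Code φ β p (suc n)
    to (inj₁ refl)                        = last
    to (inj₂ (inj₁ d))                    = fromLeft _ d
    to (inj₂ (inj₂ (inj₁ (x , x<p , e)))) = turn x x<p e
    to (inj₂ (inj₂ (inj₂ e)))             = high e

    from : ∀ {φ n} → Code φ β p (suc n)
         → n ≡ 0 ⊎ Left φ β p n ⊎ Below (turnRange φ p) (λ x → Code rising β x n) ⊎ Code⁺ φ β p (suc n)
    from last           = inj₁ refl
    from (left d)       = inj₂ (inj₁ d)
    from (turn x x<p e) = inj₂ (inj₂ (inj₁ (x , x<p , e)))
    from (high e)       = inj₂ (inj₂ (inj₂ e))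

    to∘from : ∀ {φ n} (c : Code φ β p (suc n)) → to (from c) ≡ c
    to∘from last           = refl
    to∘from (left d)       = refl
    to∘from (turn x x<p e) = refl
    to∘from (high e)       = refl

    from∘to : ∀ φ {n} s → from {φ} {n} (to s) ≡ s
    from∘to φ       (inj₁ refl)             = refl
    from∘to falling (inj₂ (inj₁ d))         = refl
    from∘to φ       (inj₂ (inj₂ (inj₁ b)))  = refl
    from∘to φ       (inj₂ (inj₂ (inj₂ e)))  = refl

  code⁺-unfold : ∀ {φ β p n} →
    (Code φ β (raise β p) n ⊎ Below (suc p) (λ x → Code⁺ φ fixed x n)) ↔ Code⁺ φ β p (suc n)
  code⁺-unfold = mk↔ₛ′
    (λ { (inj₁ e) → up e ; (inj₂ (x , x≤p , e)) → right x x≤p e })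
    (λ { (up e) → inj₁ e ; (right x x≤p e) → inj₂ (x , x≤p , e) })
    (λ { (up e) → refl ; (right x x≤p e) → refl })
    (λ { (inj₁ e) → refl ; (inj₂ (x , x≤p , e)) → refl })

  drop-unfold : ∀ {β p n} → (Code falling β p (suc n) ⊎ Drop β (suc p) n) ↔ Drop β p (suc n)
  drop-unfold = mk↔ₛ′
    (λ { (inj₁ e) → stay e ; (inj₂ d) → down d })
    (λ { (stay e) → inj₁ e ; (down d) → inj₂ d })
    (λ { (stay e) → refl ; (down d) → refl })
    (λ { (inj₁ e) → refl ; (inj₂ d) → refl })

  mutual
    ¬code-zero : ∀ {φ β p} → ¬ Code φ β p 0
    ¬code-zero (high ())

    ¬drop-zero : ∀ {β p} → ¬ Drop β p 0
    ¬drop-zero (stay e) = ¬code-zero e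

  fin-empty : ∀ {A : Set} → ¬ A → Fin 0 ↔ A
  fin-empty ¬a = 0↔⊥ ⟫ mk↔ₛ′ (λ ()) ¬a (λ a → ⊥-elim (¬a a)) (λ ())

  finIsZero : ∀ n → Fin (isZero n) ↔ (n ≡ 0)
  finIsZero zero    = 1↔⊤ ⟫ mk↔ₛ′ (λ _ → refl) (λ _ → tt) (λ { refl → refl }) (λ _ → refl)
  finIsZero (suc n) = fin-empty (λ ())

  finCode  : ∀ φ β p n → Fin (#Code φ β p n) ↔ Code φ β p n
  finCode⁺ : ∀ φ β p n → Fin (#Code⁺ φ β p n) ↔ Code⁺ φ β p n
  finDrop  : ∀ β p n → Fin (#Drop β p n) ↔ Drop β p n
  finLeft  : ∀ φ β p n → Fin (#Left φ β p n) ↔ Left φ β p n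

  finCode φ β p zero    = fin-empty ¬code-zero
  finCode φ β p (suc n) =
    +↔⊎ ⟫ (finIsZero n ⊎-↔ (+↔⊎ ⟫ (finLeft φ β p n ⊎-↔
      (+↔⊎ ⟫ (finBelow (turnRange φ p) (λ x → finCode rising β x n) ⊎-↔ finCode⁺ φ β p (suc n))))))
    ⟫ code-unfold

  finCode⁺ φ β p zero    = fin-empty (λ ())
  finCode⁺ φ β p (suc n) =
    +↔⊎ ⟫ (finCode φ β (raise β p) n ⊎-↔ finBelow (suc p) (λ x → finCode⁺ φ fixed x n)) ⟫ code⁺-unfold

  finDrop β p zero    = fin-empty ¬drop-zero
  finDrop β p (suc n) = +↔⊎ ⟫ (finCode falling β p (suc n) ⊎-↔ finDrop β (suc p) n) ⟫ drop-unfold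

  finLeft falling β p n = finDrop β p n
  finLeft rising  β p n = 0↔⊥

-- The relation between codes and column profiles.

module Matching where

  open Codes
  open import Data.Nat using (ℕ; suc; _+_; _∸_; _<_; _≤_; s≤s; s≤s⁻¹)
  open import Data.Nat.Properties
  open import Data.Product using (Σ; _×_; _,_)
  open import Data.Sum using (inj₁; inj₂)
  open import Relation.Nullary using (contradiction; yes; no)
  open import Relation.Binary.PropositionalEquality using (_≡_; _≢_; refl; sym; trans; cong)

  -- The code is the history of peeling columns i … j of the profile from height y on, where
  -- a = l i, f is the least lower end and t the greatest upper end.  For FitsDrop, a is the
  -- lower end of column i - 1 lowered by the steps already taken.
  mutual
    data Fits (l u : ℕ → ℕ) : ∀ {φ β p n} → Code φ β p n → (i j f t a y : ℕ) → Set where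
      last : ∀ {φ β p i a y} → l i ≡ a → u i ≡ y → Fits l u (last {φ} {β} {p}) i i a y a y
      left : ∀ {β p n} {d : Drop β p n} {i j f t a y} → l i ≡ a → u i ≡ y →
        FitsDrop l u d (suc i) j f t a y → Fits l u (left d) i j f t a y
      turn : ∀ {φ β p n x} {x< : x < turnRange φ p} {c : Code rising β x n} {i j t a b y} → l i ≡ a → u i ≡ y →
        b + x ≡ a + p → Fits l u c (suc i) j b t b y → Fits l u (turn {φ} x x< c) i j a t a y
      high : ∀ {φ β p n} {c : Code⁺ φ β p n} {i j f t a y} →
        Fits⁺ l u c i j f t a y → Fits l u (high c) i j f t a y

    data Fits⁺ (l u : ℕ → ℕ) : ∀ {φ β p n} → Code⁺ φ β p n → (i j f t a y : ℕ) → Set where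
      up : ∀ {φ β p n} {c : Code φ β (raise β p) n} {i j f t a y} →
        Fits l u c i j f t a (suc y) → Fits⁺ l u (up c) i j f t a y
      right : ∀ {φ β p n x} {x≤ : x < suc p} {c : Code⁺ φ fixed x n} {i j f t a y} →
        l (suc j) ≡ a + x → u (suc j) ≡ y → Fits⁺ l u c i j f t a y →
        Fits⁺ l u (right {φ} {β} x x≤ c) i (suc j) f t a y

    data FitsDrop (l u : ℕ → ℕ) : ∀ {β p n} → Drop β p n → (i j f t a y : ℕ) → Set where
      stay : ∀ {β p n} {c : Code falling β p n} {i j f t a y} →
        Fits l u c i j f t a y → FitsDrop l u (stay c) i j f t a y
      down : ∀ {β p n} {d : Drop β (suc p) n} {i j f t a y} →
        FitsDrop l u d i j f t a y → FitsDrop l u (down d) i j f t (suc a) y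

  module _ {l u : ℕ → ℕ} where
    mutual
      -- Removing a column moves `i` or `j`, `up` moves `y` and `down` moves `a`, each by one. At a
      -- `turn` the terms `f` and `a` coincide and cancel, so a rise of the lower end is free. For a
      -- whole code, i = f = 0 and y = a give n = j + 1 + t.
      size : ∀ {φ β p n} {c : Code φ β p n} {i j f t a y} → Fits l u c i j f t a y → n + i + y + f ≡ suc j + t + a
      size {i = i} {a = a} {y = y} (last _ _) = refl
      size {n = suc n} {i = i} {f = f} {y = y} (left _ _ d) =
        trans (cong (λ m → m + y + f) (sym (+-suc n i))) (sizeDrop d)
      size {n = suc n} {i = i} {j} {f} {t} {a} {y} (turn {b = b} _ _ _ c) =
        cong (_+ a) (trans (cong (_+ y) (sym (+-suc n i))) (+-cancelʳ-≡ b _ _ (size c)))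
      size (high c) = size⁺ c

      size⁺ : ∀ {φ β p n} {c : Code⁺ φ β p n} {i j f t a y} → Fits⁺ l u c i j f t a y → n + i + y + f ≡ suc j + t + a
      size⁺ {n = suc n} {i = i} {f = f} {y = y} (up c) = trans (cong (_+ f) (sym (+-suc (n + i) y))) (size c)
      size⁺ (right _ _ c) = cong suc (size⁺ c)

      sizeDrop : ∀ {β p n} {d : Drop β p n} {i j f t a y} → FitsDrop l u d i j f t a y → n + i + y + f ≡ suc j + t + a
      sizeDrop (stay c) = size c
      sizeDrop {j = j} {t = t} {a = suc a} (down d) = trans (cong suc (sizeDrop d)) (sym (+-suc (suc j + t) a))

    mutual
      first : ∀ {φ β p n} {c : Code φ β p n} {i j f t a y} → Fits l u c i j f t a y → l i ≡ a
      first (last e _) = e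
      first (left e _ _) = e
      first (turn e _ _ _) = e
      first (high c) = first⁺ c

      first⁺ : ∀ {φ β p n} {c : Code⁺ φ β p n} {i j f t a y} → Fits⁺ l u c i j f t a y → l i ≡ a
      first⁺ (up c) = first c
      first⁺ (right _ _ c) = first⁺ c

    firstDrop : ∀ {β p n} {d : Drop β p n} {i j f t a y} → FitsDrop l u d i j f t a y → l i ≤ a
    firstDrop (stay c) = ≤-reflexive (first c)
    firstDrop (down d) = m≤n⇒m≤1+n (firstDrop d)

    mutual
      range : ∀ {φ β p n} {c : Code φ β p n} {i j f t a y} → Fits l u c i j f t a y → i ≤ j
      range (last _ _) = ≤-refl
      range (left _ _ d) = <⇒≤ (rangeDrop d)
      range (turn _ _ _ c) = <⇒≤ (range c)
      range (high c) = range⁺ c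

      range⁺ : ∀ {φ β p n} {c : Code⁺ φ β p n} {i j f t a y} → Fits⁺ l u c i j f t a y → i ≤ j
      range⁺ (up c) = range c
      range⁺ (right _ _ c) = m≤n⇒m≤1+n (range⁺ c)

      rangeDrop : ∀ {β p n} {d : Drop β p n} {i j f t a y} → FitsDrop l u d i j f t a y → i ≤ j
      rangeDrop (stay c) = range c
      rangeDrop (down d) = rangeDrop d

    mutual
      above : ∀ {φ β p n} {c : Code φ β p n} {i j f t a y} → Fits l u c i j f t a y →
        ∀ x → i ≤ x → x ≤ j → y ≤ u x
      above (last _ e) x i≤x x≤j with refl ← ≤-antisym i≤x x≤j = ≤-reflexive (sym e)
      above (left _ e d) x i≤x x≤j with m≤n⇒m<n∨m≡n i≤x
      ... | inj₁ i<x  = aboveDrop d x i<x x≤j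
      ... | inj₂ refl = ≤-reflexive (sym e)
      above (turn _ e _ c) x i≤x x≤j with m≤n⇒m<n∨m≡n i≤x
      ... | inj₁ i<x  = above c x i<x x≤j
      ... | inj₂ refl = ≤-reflexive (sym e)
      above (high c) = above⁺ c

      above⁺ : ∀ {φ β p n} {c : Code⁺ φ β p n} {i j f t a y} → Fits⁺ l u c i j f t a y →
        ∀ x → i ≤ x → x ≤ j → y ≤ u x
      above⁺ (up c) x i≤x x≤j = <⇒≤ (above c x i≤x x≤j)
      above⁺ (right _ e c) x i≤x x≤j with m≤n⇒m<n∨m≡n x≤j
      ... | inj₁ x<j  = above⁺ c x i≤x (s≤s⁻¹ x<j)
      ... | inj₂ refl = ≤-reflexive (sym e)

      aboveDrop : ∀ {β p n} {d : Drop β p n} {i j f t a y} → FitsDrop l u d i j f t a y →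
        ∀ x → i ≤ x → x ≤ j → y ≤ u x
      aboveDrop (stay c) = above c
      aboveDrop (down d) = aboveDrop d

    -- Separates `high` from the three other constructors: under `high` the first column is removed
    -- only after an `up`, hence at a larger height.
    first-above : ∀ {φ β p n} {c : Code⁺ φ β p n} {i j f t a y} → Fits⁺ l u c i j f t a y → y < u i
    first-above (up c) = above c _ ≤-refl (range c)
    first-above (right _ _ c) = first-above c

    -- The profile decides the constructor at each node.
    mutual
      unique : ∀ {φ β p n} {c c′ : Code φ β p n} {i j f f′ t t′ a a′ y} →
        Fits l u c i j f t a y → Fits l u c′ i j f′ t′ a′ y → c ≡ c′
      unique (last _ _) (last _ _) = refl
      unique (last _ _) (left _ _ d) = contradiction (rangeDrop d) (<-irrefl refl)
      unique (last _ _) (turn _ _ _ c) = contradiction (range c) (<-irrefl refl)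
      unique (last _ e) (high c) = contradiction (first-above c) (<-irrefl (sym e))
      unique (left _ _ d) (last _ _) = contradiction (rangeDrop d) (<-irrefl refl)
      unique (left l≡ _ d) (left l≡′ _ d′) = cong left (uniqueDrop (trans (sym l≡) l≡′) d d′)
      unique (left l≡ _ d) (turn {x< = x<} l≡′ _ b+x c) =
        contradiction (firstDrop d) (<⇒≱ (turn-rises x< (trans (sym l≡′) l≡) b+x (first c)))
      unique (left _ e d) (high c) = contradiction (first-above c) (<-irrefl (sym e))
      unique (turn _ _ _ c) (last _ _) = contradiction (range c) (<-irrefl refl)
      unique (turn {x< = x<} l≡ _ b+x c) (left l≡′ _ d) =
        contradiction (firstDrop d) (<⇒≱ (turn-rises x< (trans (sym l≡) l≡′) b+x (first c)))
      unique (turn {x = x} {x<} {b = b} l≡ _ b+x c) (turn {x = x′} {x<′} l≡′ _ b+x′ c′)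
        with refl ← trans (sym l≡) l≡′ | refl ← trans (sym (first c)) (first c′)
        with refl ← +-cancelˡ-≡ b x x′ (trans b+x (sym b+x′))
        with refl ← ≤-irrelevant x< x<′
        = cong (turn _ x<) (unique c c′)
      unique (turn _ e _ _) (high c) = contradiction (first-above c) (<-irrefl (sym e))
      unique (high c) (last _ e) = contradiction (first-above c) (<-irrefl (sym e))
      unique (high c) (left _ e _) = contradiction (first-above c) (<-irrefl (sym e))
      unique (high c) (turn _ e _ _) = contradiction (first-above c) (<-irrefl (sym e))
      unique (high c) (high c′) = cong high (unique⁺ c c′)

      -- The bound is kept while its distance shrinks from p to x, so the lower end moves up. After
      -- `left` it cannot (`firstDrop`), hence the two constructors exclude each other.
      turn-rises : ∀ {x p a a′ b i} → x < p → a ≡ a′ → b + x ≡ a + p → l i ≡ b → a′ < l i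
      turn-rises {x} {p} {a} {b = b} x<p refl b+x refl =
        ≰⇒> λ b≤a → <-irrefl b+x (+-mono-≤-< b≤a x<p)

      unique⁺ : ∀ {φ β p n} {c c′ : Code⁺ φ β p n} {i j f f′ t t′ a a′ y} →
        Fits⁺ l u c i j f t a y → Fits⁺ l u c′ i j f′ t′ a′ y → c ≡ c′
      unique⁺ (up c) (up c′) = cong up (unique c c′)
      unique⁺ (up c) (right _ e _) = contradiction (above c _ (range c) ≤-refl) (<-irrefl (sym e))
      unique⁺ (right _ e _) (up c) = contradiction (above c _ (range c) ≤-refl) (<-irrefl (sym e))
      unique⁺ (right {x = x} {x≤} {a = a} l≡ _ c) (right {x = x′} {x≤′} l≡′ _ c′)
        with refl ← trans (sym (first⁺ c)) (first⁺ c′)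
        with refl ← +-cancelˡ-≡ a x x′ (trans (sym l≡) l≡′)
        with refl ← ≤-irrelevant x≤ x≤′
        = cong (right _ x≤) (unique⁺ c c′)

      uniqueDrop : ∀ {β p n} {d d′ : Drop β p n} {i j f f′ t t′ a a′ y} → a ≡ a′ →
        FitsDrop l u d i j f t a y → FitsDrop l u d′ i j f′ t′ a′ y → d ≡ d′
      uniqueDrop _ (stay c) (stay c′) = cong stay (unique c c′)
      uniqueDrop refl (stay c) (down d) = contradiction (firstDrop d) (<⇒≱ (≤-reflexive (sym (first c))))
      uniqueDrop refl (down d) (stay c) = contradiction (firstDrop d) (<⇒≱ (≤-reflexive (sym (first c))))
      uniqueDrop e (down d) (down d′) = cong down (uniqueDrop (suc-injective e) d d′)

  mutual
    fits-local : ∀ {l u l′ u′ φ β p n} {c : Code φ β p n} {i j f t a y} →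
      (∀ x → i ≤ x → x ≤ j → l x ≡ l′ x × u x ≡ u′ x) → Fits l u c i j f t a y → Fits l′ u′ c i j f t a y
    fits-local {i = i} h (last e e′) with h i ≤-refl ≤-refl
    ... | p , q = last (trans (sym p) e) (trans (sym q) e′)
    fits-local {i = i} h (left e e′ d) with h i ≤-refl (<⇒≤ (rangeDrop d))
    ... | p , q = left (trans (sym p) e) (trans (sym q) e′) (fitsDrop-local (λ x i<x → h x (<⇒≤ i<x)) d)
    fits-local {i = i} h (turn e e′ b+x c) with h i ≤-refl (<⇒≤ (range c))
    ... | p , q = turn (trans (sym p) e) (trans (sym q) e′) b+x (fits-local (λ x i<x → h x (<⇒≤ i<x)) c)
    fits-local h (high c) = high (fits⁺-local h c)

    fits⁺-local : ∀ {l u l′ u′ φ β p n} {c : Code⁺ φ β p n} {i j f t a y} →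
      (∀ x → i ≤ x → x ≤ j → l x ≡ l′ x × u x ≡ u′ x) → Fits⁺ l u c i j f t a y → Fits⁺ l′ u′ c i j f t a y
    fits⁺-local h (up c) = up (fits-local h c)
    fits⁺-local {j = suc j} h (right e e′ c) with h (suc j) (m≤n⇒m≤1+n (range⁺ c)) ≤-refl
    ... | p , q = right (trans (sym p) e) (trans (sym q) e′) (fits⁺-local (λ x i≤x x≤j → h x i≤x (m≤n⇒m≤1+n x≤j)) c)

    fitsDrop-local : ∀ {l u l′ u′ β p n} {d : Drop β p n} {i j f t a y} →
      (∀ x → i ≤ x → x ≤ j → l x ≡ l′ x × u x ≡ u′ x) → FitsDrop l u d i j f t a y → FitsDrop l′ u′ d i j f t a y
    fitsDrop-local h (stay c) = stay (fits-local h c)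
    fitsDrop-local h (down d) = down (fitsDrop-local h d)

  -- How far the first lower end lies above the least one. Lower ends only rise after a `turn`, so
  -- nothing later counts.
  depth  : ∀ {φ β p n} → Code φ β p n → ℕ
  depth⁺ : ∀ {φ β p n} → Code⁺ φ β p n → ℕ
  depthDrop : ∀ {β p n} → Drop β p n → ℕ
  depth last         = 0
  depth (left d)     = depthDrop d
  depth (turn _ _ _) = 0
  depth (high c)     = depth⁺ c
  depth⁺ (up c)        = depth c
  depth⁺ (right _ _ c) = depth⁺ c
  depthDrop (stay c) = depth c
  depthDrop (down d) = suc (depthDrop d)

  mutual
    depth-rising : ∀ {β p n} (c : Code rising β p n) → depth c ≡ 0
    depth-rising last         = refl
    depth-rising (turn _ _ _) = refl
    depth-rising (high c)     = depth⁺-rising c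

    depth⁺-rising : ∀ {β p n} (c : Code⁺ rising β p n) → depth⁺ c ≡ 0
    depth⁺-rising (up c)        = depth-rising c
    depth⁺-rising (right _ _ c) = depth⁺-rising c

  set : (ℕ → ℕ) → ℕ → ℕ → ℕ → ℕ
  set g k v x with x ≟ k
  ... | yes _ = v
  ... | no  _ = g x

  set-at : ∀ g k v → set g k v k ≡ v
  set-at g k v with k ≟ k
  ... | yes _ = refl
  ... | no ¬p = contradiction refl ¬p

  set-away : ∀ g k v x → x ≢ k → g x ≡ set g k v x
  set-away g k v x x≢k with x ≟ k
  ... | yes p = contradiction p x≢k
  ... | no  _ = refl

  set-away₂ : ∀ (l u : ℕ → ℕ) k v w {x} → x ≢ k → l x ≡ set l k v x × u x ≡ set u k w x
  set-away₂ l u k v w x≢k = set-away l k v _ x≢k , set-away u k w _ x≢k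

  Profiled : ((ℕ → ℕ) → (ℕ → ℕ) → ℕ → ℕ → Set) → Set
  Profiled F = Σ (ℕ → ℕ) λ l → Σ (ℕ → ℕ) λ u → Σ ℕ λ j → Σ ℕ λ t → F l u j t

  turn-sum : ∀ a {x p} → x ≤ p → a + (p ∸ x) + x ≡ a + p
  turn-sum a {x} {p} x≤p = trans (+-assoc a (p ∸ x) x) (cong (a +_) (m∸n+n≡m x≤p))

  turnRange-≤ : ∀ φ {x p} → x < turnRange φ p → x ≤ p
  turnRange-≤ falling = <⇒≤
  turnRange-≤ rising  = s≤s⁻¹

  mutual
    -- The least lower end `f` is prescribed and the first one is computed from it, so falling lower
    -- ends never leave ℕ. Columns are built from the inside out; overriding the outermost one does
    -- not disturb the rest, by `fits-local`.
    profile : ∀ {φ β p n} (c : Code φ β p n) i f y {a} → a ≡ f + depth c →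
      Profiled λ l u j t → Fits l u c i j f t a y
    profile last i f y a≡ with refl ← trans a≡ (+-identityʳ f) =
      (λ _ → f) , (λ _ → y) , i , y , last refl refl
    profile (left d) i f y {a} a≡ with profileDrop d (suc i) f y a≡
    ... | l , u , j , t , fits =
      set l i a , set u i y , j , t ,
      left (set-at l i a) (set-at u i y)
        (fitsDrop-local (λ x i<x _ → set-away₂ l u i a y (>⇒≢ i<x)) fits)
    profile (turn {φ} {p = p} x x< c) i f y a≡
      with refl ← trans a≡ (+-identityʳ f)
      -- The remaining lower ends rise, so the next one is their floor; it is the solution b of b +
      -- x = f + p, which leaves the right-hand bound in place.
      with profile c (suc i) (f + (p ∸ x)) y (sym (trans (cong (f + (p ∸ x) +_) (depth-rising c)) (+-identityʳ _)))
    ... | l , u , j , t , fits =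
      set l i f , set u i y , j , t ,
      turn (set-at l i f) (set-at u i y) (turn-sum f (turnRange-≤ φ x<))
        (fits-local (λ x i<x _ → set-away₂ l u i f y (>⇒≢ i<x)) fits)
    profile (high c) i f y a≡ with profile⁺ c i f y a≡
    ... | l , u , j , t , fits = l , u , j , t , high fits

    profile⁺ : ∀ {φ β p n} (c : Code⁺ φ β p n) i f y {a} → a ≡ f + depth⁺ c →
      Profiled λ l u j t → Fits⁺ l u c i j f t a y
    profile⁺ (up c) i f y a≡ with profile c i f (suc y) a≡
    ... | l , u , j , t , fits = l , u , j , t , up fits
    profile⁺ (right x x≤ c) i f y {a} a≡ with profile⁺ c i f y a≡
    ... | l , u , j , t , fits =
      set l (suc j) (a + x) , set u (suc j) y , suc j , t ,
      right (set-at l (suc j) _) (set-at u (suc j) y)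
        (fits⁺-local (λ z _ z≤j → set-away₂ l u (suc j) (a + x) y (<⇒≢ (s≤s z≤j))) fits)

    profileDrop : ∀ {β p n} (d : Drop β p n) i f y {a} → a ≡ f + depthDrop d →
      Profiled λ l u j t → FitsDrop l u d i j f t a y
    profileDrop (stay c) i f y a≡ with profile c i f y a≡
    ... | l , u , j , t , fits = l , u , j , t , stay fits
    profileDrop (down d) i f y a≡ with refl ← trans a≡ (+-suc f _) with profileDrop d i f y refl
    ... | l , u , j , t , fits = l , u , j , t , down fits

-- Codes describe precisely the ascending profiles: soundness and completeness.

module Profiles where

  open Codes
  open Matching
  open import Data.Nat using (ℕ; zero; suc; _+_; _∸_; _<_; _≤_; s≤s; s≤s⁻¹)
  open import Data.Nat.Properties
  open import Data.Product using (Σ; _×_; _,_; proj₁; proj₂)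
  open import Data.Sum using (_⊎_; inj₁; inj₂)
  open import Data.Unit using (⊤)
  open import Relation.Nullary using (contradiction)
  open import Relation.Binary.PropositionalEquality using (_≡_; refl; sym; trans; cong; subst)

  record Ascending (l u : ℕ → ℕ) (i j : ℕ) : Set where
    field
      nonempty   : ∀ x → i ≤ x → x ≤ j → l x ≤ u x
      adjacent    : ∀ x → i ≤ x → x < j → l (suc x) ≤ u x × l x ≤ u (suc x)
      unimodal   : ∀ x y z → i ≤ x → x < y → y < z → z ≤ j → u x ≤ u y ⊎ u z ≤ u y
      valley     : ∀ x y z → i ≤ x → x < y → y < z → z ≤ j → l y ≤ l x ⊎ l y ≤ l z
      comparable : ∀ x y → i ≤ x → x < y → y ≤ j → u x ≤ u y ⊎ l x ≤ l y

  open Ascending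

  module _ {l u : ℕ → ℕ} where

    restrict : ∀ {i j i′ j′} → i ≤ i′ → j′ ≤ j → Ascending l u i j → Ascending l u i′ j′
    restrict p q A .nonempty x i≤x x≤j = A .nonempty x (≤-trans p i≤x) (≤-trans x≤j q)
    restrict p q A .adjacent x i≤x x<j = A .adjacent x (≤-trans p i≤x) (≤-trans x<j q)
    restrict p q A .unimodal x y z i≤x x<y y<z z≤j = A .unimodal x y z (≤-trans p i≤x) x<y y<z (≤-trans z≤j q)
    restrict p q A .valley x y z i≤x x<y y<z z≤j = A .valley x y z (≤-trans p i≤x) x<y y<z (≤-trans z≤j q)
    restrict p q A .comparable x y i≤x x<y y≤j = A .comparable x y (≤-trans p i≤x) x<y (≤-trans y≤j q)

    single : ∀ {i} → l i ≤ u i → Ascending l u i i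
    single l≤u .nonempty x i≤x x≤i with refl ← ≤-antisym i≤x x≤i = l≤u
    single l≤u .adjacent x i≤x x<i = contradiction x<i (≤⇒≯ i≤x)
    single l≤u .unimodal x y z i≤x x<y y<z z≤i = contradiction (<-trans x<y y<z) (≤⇒≯ (≤-trans z≤i i≤x))
    single l≤u .valley x y z i≤x x<y y<z z≤i = contradiction (<-trans x<y y<z) (≤⇒≯ (≤-trans z≤i i≤x))
    single l≤u .comparable x y i≤x x<y y≤i = contradiction x<y (≤⇒≯ (≤-trans y≤i i≤x))

    -- The new column has the least upper end, which settles unimodality and comparability by their
    -- first alternatives.
    extendLeft : ∀ {i j} → l i ≤ u i → l (suc i) ≤ u i →
      (∀ x → i < x → x ≤ j → u i ≤ u x) →
      (∀ y z → i < y → y < z → z ≤ j → l y ≤ l i ⊎ l y ≤ l z) →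
      Ascending l u (suc i) j → Ascending l u i j
    extendLeft {i} {j} l≤u l′≤u ui≤ vl A = record
      { nonempty = ne ; adjacent = ov ; unimodal = um ; valley = va ; comparable = co }
      where
      ne : ∀ x → i ≤ x → x ≤ j → l x ≤ u x
      ne x i≤x x≤j with m≤n⇒m<n∨m≡n i≤x
      ... | inj₁ i<x  = A .nonempty x i<x x≤j
      ... | inj₂ refl = l≤u
      ov : ∀ x → i ≤ x → x < j → l (suc x) ≤ u x × l x ≤ u (suc x)
      ov x i≤x x<j with m≤n⇒m<n∨m≡n i≤x
      ... | inj₁ i<x  = A .adjacent x i<x x<j
      ... | inj₂ refl = l′≤u , ≤-trans l≤u (ui≤ (suc x) ≤-refl x<j)
      um : ∀ x y z → i ≤ x → x < y → y < z → z ≤ j → u x ≤ u y ⊎ u z ≤ u y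
      um x y z i≤x x<y y<z z≤j with m≤n⇒m<n∨m≡n i≤x
      ... | inj₁ i<x  = A .unimodal x y z i<x x<y y<z z≤j
      ... | inj₂ refl = inj₁ (ui≤ y x<y (≤-trans (<⇒≤ y<z) z≤j))
      va : ∀ x y z → i ≤ x → x < y → y < z → z ≤ j → l y ≤ l x ⊎ l y ≤ l z
      va x y z i≤x x<y y<z z≤j with m≤n⇒m<n∨m≡n i≤x
      ... | inj₁ i<x  = A .valley x y z i<x x<y y<z z≤j
      ... | inj₂ refl = vl y z x<y y<z z≤j
      co : ∀ x y → i ≤ x → x < y → y ≤ j → u x ≤ u y ⊎ l x ≤ l y
      co x y i≤x x<y y≤j with m≤n⇒m<n∨m≡n i≤x
      ... | inj₁ i<x  = A .comparable x y i<x x<y y≤j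
      ... | inj₂ refl = inj₁ (ui≤ y x<y y≤j)

    -- The new column has the least upper end and the greatest lower end: all three order conditions
    -- hold by their second alternatives, and its interval already lies inside the reach of its
    -- neighbour.
    extendRight : ∀ {i j} → i ≤ j → l (suc j) ≤ u (suc j) →
      (∀ x → i ≤ x → x ≤ j → u (suc j) ≤ u x) →
      (∀ x → i ≤ x → x ≤ j → l x ≤ l (suc j)) →
      Ascending l u i j → Ascending l u i (suc j)
    extendRight {i} {j} i≤j l≤u uj≤ ≤lj A = record
      { nonempty = ne ; adjacent = ov ; unimodal = um ; valley = va ; comparable = co }
      where
      ne : ∀ x → i ≤ x → x ≤ suc j → l x ≤ u x
      ne x i≤x x≤j with m≤n⇒m<n∨m≡n x≤j
      ... | inj₁ x<j  = A .nonempty x i≤x (s≤s⁻¹ x<j)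
      ... | inj₂ refl = l≤u
      ov : ∀ x → i ≤ x → x < suc j → l (suc x) ≤ u x × l x ≤ u (suc x)
      ov x i≤x x<j with m≤n⇒m<n∨m≡n (s≤s⁻¹ x<j)
      ... | inj₁ x<j′ = A .adjacent x i≤x x<j′
      ... | inj₂ refl = ≤-trans l≤u (uj≤ x i≤x ≤-refl) , ≤-trans (≤lj x i≤x ≤-refl) l≤u
      um : ∀ x y z → i ≤ x → x < y → y < z → z ≤ suc j → u x ≤ u y ⊎ u z ≤ u y
      um x y z i≤x x<y y<z z≤j with m≤n⇒m<n∨m≡n z≤j
      ... | inj₁ z<j  = A .unimodal x y z i≤x x<y y<z (s≤s⁻¹ z<j)
      ... | inj₂ refl = inj₂ (uj≤ y (≤-trans i≤x (<⇒≤ x<y)) (s≤s⁻¹ y<z))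
      va : ∀ x y z → i ≤ x → x < y → y < z → z ≤ suc j → l y ≤ l x ⊎ l y ≤ l z
      va x y z i≤x x<y y<z z≤j with m≤n⇒m<n∨m≡n z≤j
      ... | inj₁ z<j  = A .valley x y z i≤x x<y y<z (s≤s⁻¹ z<j)
      ... | inj₂ refl = inj₂ (≤lj y (≤-trans i≤x (<⇒≤ x<y)) (s≤s⁻¹ y<z))
      co : ∀ x y → i ≤ x → x < y → y ≤ suc j → u x ≤ u y ⊎ l x ≤ l y
      co x y i≤x x<y y≤j with m≤n⇒m<n∨m≡n y≤j
      ... | inj₁ y<j  = A .comparable x y i≤x x<y (s≤s⁻¹ y<j)
      ... | inj₂ refl = inj₂ (≤lj x i≤x (s≤s⁻¹ x<y))

  -- What peeling from outside reveals about columns i … j: f is the least lower end, t the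
  -- greatest upper end, and b bounds the lower ends once a column on the right has been removed.
  record Shape (l u : ℕ → ℕ) (φ : Phase) (β : Bound) (i j f t b : ℕ) : Set where
    field
      ascending : Ascending l u i j
      floor≤    : ∀ x → i ≤ x → x ≤ j → f ≤ l x
      floor     : Σ ℕ λ x → i ≤ x × x ≤ j × l x ≡ f
      ≤top      : ∀ x → i ≤ x → x ≤ j → u x ≤ t
      top       : Σ ℕ λ x → i ≤ x × x ≤ j × u x ≡ t
      capped    : β ≡ fixed → ∀ x → i ≤ x → x ≤ j → l x ≤ b
      monotone  : φ ≡ rising → ∀ x z → i ≤ x → x ≤ z → z ≤ j → l x ≤ l z

  open Shape

  module _ {l u : ℕ → ℕ} where

    -- Shared by `left`, with ψ = falling and f′ = f, and `turn`, with ψ = rising, f = a and f′ the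
    -- next lower end.
    peeled-left : ∀ {φ ψ β i j f f′ t a b y} → l i ≡ a → u i ≡ y → a ≤ b → b ≤ y → i < j → f ≤ f′ → f ≤ a →
      l (suc i) ≤ y →
      (∀ x → i < x → x ≤ j → y ≤ u x) →
      (∀ y z → i < y → y < z → z ≤ j → l y ≤ a ⊎ l y ≤ l z) →
      (Σ ℕ λ x → i ≤ x × x ≤ j × l x ≡ f) →
      (φ ≡ rising → ψ ≡ rising × a ≤ l (suc i)) →
      Shape l u ψ β (suc i) j f′ t b → Shape l u φ β i j f t b
    peeled-left {φ} {β = β} {i} {j} {f} {t = t} {b = b} refl refl a≤b b≤y i<j f≤f′ f≤a l′≤y y≤ vl fl mono S = record
      { ascending = extendLeft (≤-trans a≤b b≤y) l′≤y y≤ vl (S .ascending)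
      ; floor≤ = fl≤ ; floor = fl ; ≤top = tp≤
      ; top = let x , p , q , r = S .top in x , <⇒≤ p , q , r
      ; capped = cp ; monotone = mo }
      where
      fl≤ : ∀ x → i ≤ x → x ≤ j → f ≤ l x
      fl≤ x i≤x x≤j with m≤n⇒m<n∨m≡n i≤x
      ... | inj₁ i<x  = ≤-trans f≤f′ (S .floor≤ x i<x x≤j)
      ... | inj₂ refl = f≤a
      tp≤ : ∀ x → i ≤ x → x ≤ j → u x ≤ t
      tp≤ x i≤x x≤j with m≤n⇒m<n∨m≡n i≤x
      ... | inj₁ i<x  = S .≤top x i<x x≤j
      ... | inj₂ refl = ≤-trans (y≤ (suc i) ≤-refl i<j) (S .≤top (suc i) ≤-refl i<j)
      cp : β ≡ fixed → ∀ x → i ≤ x → x ≤ j → l x ≤ b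
      cp e x i≤x x≤j with m≤n⇒m<n∨m≡n i≤x
      ... | inj₁ i<x  = S .capped e x i<x x≤j
      ... | inj₂ refl = a≤b
      mo : φ ≡ rising → ∀ x z → i ≤ x → x ≤ z → z ≤ j → l x ≤ l z
      mo e x z i≤x x≤z z≤j with m≤n⇒m<n∨m≡n i≤x | m≤n⇒m<n∨m≡n x≤z
      ... | inj₁ i<x  | _         = S .monotone (proj₁ (mono e)) x z i<x x≤z z≤j
      ... | inj₂ refl | inj₂ refl = ≤-refl
      ... | inj₂ refl | inj₁ x<z  = ≤-trans (proj₂ (mono e)) (S .monotone (proj₁ (mono e)) (suc x) z ≤-refl x<z z≤j)

    peeled-right : ∀ {φ β i j f t a b b′ y} → i ≤ j → l i ≡ a → a ≤ b → l (suc j) ≡ b → u (suc j) ≡ y → b ≤ y →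
      b ≤ b′ → (∀ x → i ≤ x → x ≤ j → y ≤ u x) →
      Shape l u φ fixed i j f t b → Shape l u φ β i (suc j) f t b′
    peeled-right {φ} {β} {i} {j} {f} {t = t} {b′ = b′} i≤j refl a≤b refl refl b≤y b≤b′ y≤ S = record
      { ascending = extendRight i≤j b≤y y≤ (S .capped refl) (S .ascending)
      ; floor≤ = fl≤
      ; floor = let x , p , q , r = S .floor in x , p , m≤n⇒m≤1+n q , r
      ; ≤top = tp≤
      ; top = let x , p , q , r = S .top in x , p , m≤n⇒m≤1+n q , r
      ; capped = cp ; monotone = mo }
      where
      fl≤ : ∀ x → i ≤ x → x ≤ suc j → f ≤ l x
      fl≤ x i≤x x≤j with m≤n⇒m<n∨m≡n x≤j
      ... | inj₁ x<j  = S .floor≤ x i≤x (s≤s⁻¹ x<j)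
      ... | inj₂ refl = ≤-trans (S .floor≤ i ≤-refl i≤j) a≤b
      tp≤ : ∀ x → i ≤ x → x ≤ suc j → u x ≤ t
      tp≤ x i≤x x≤j with m≤n⇒m<n∨m≡n x≤j
      ... | inj₁ x<j  = S .≤top x i≤x (s≤s⁻¹ x<j)
      ... | inj₂ refl = ≤-trans (y≤ i ≤-refl i≤j) (S .≤top i ≤-refl i≤j)
      cp : β ≡ fixed → ∀ x → i ≤ x → x ≤ suc j → l x ≤ b′
      cp e x i≤x x≤j with m≤n⇒m<n∨m≡n x≤j
      ... | inj₁ x<j  = ≤-trans (S .capped refl x i≤x (s≤s⁻¹ x<j)) b≤b′
      ... | inj₂ refl = b≤b′
      mo : φ ≡ rising → ∀ x z → i ≤ x → x ≤ z → z ≤ suc j → l x ≤ l z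
      mo e x z i≤x x≤z z≤j with m≤n⇒m<n∨m≡n z≤j
      ... | inj₁ z<j  = S .monotone e x z i≤x x≤z (s≤s⁻¹ z<j)
      ... | inj₂ refl with m≤n⇒m<n∨m≡n x≤z
      ...   | inj₁ x<z  = S .capped refl x i≤x (s≤s⁻¹ x<z)
      ...   | inj₂ refl = ≤-refl

    reshape : ∀ {φ β i j f t b b′} → b ≡ b′ → Shape l u φ β i j f t b → Shape l u φ β i j f t b′
    reshape refl S = S

    raise-bound : ∀ β {a p y} → a + p ≤ y → a + raise β p ≤ suc y
    raise-bound level {a} {p} h = ≤-trans (≤-reflexive (+-suc a p)) (s≤s h)
    raise-bound fixed h = m≤n⇒m≤1+n h

    -- Under `level` the bound enters only through `capped`, which is vacuous there; under `fixed`,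
    -- `raise` changes nothing.
    lowered : ∀ β {φ i j f t a p} →
      Shape l u φ β i j f t (a + raise β p) → Shape l u φ β i j f t (a + p)
    lowered level S = record { Shape S ; capped = λ () }
    lowered fixed S = S

    mutual
      -- Soundness. The invariant a + p ≤ y keeps the bound at or below the current height; since
      -- the next lower end respects the bound, it is at most the upper end of the column just
      -- removed, and the two columns meet.
      shape : ∀ {φ β p n} {c : Code φ β p n} {i j f t a y} → a + p ≤ y →
        Fits l u c i j f t a y → Shape l u φ β i j f t (a + p)
      shape {i = i} {a = a} a+p≤y (last refl refl) = record
        { ascending = single (m+n≤o⇒m≤o a a+p≤y)
        ; floor≤ = λ x i≤x x≤i → ≤-reflexive (cong l (≤-antisym i≤x x≤i))
        ; floor = i , ≤-refl , ≤-refl , refl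
        ; ≤top = λ x i≤x x≤i → ≤-reflexive (cong u (≤-antisym x≤i i≤x))
        ; top = i , ≤-refl , ≤-refl , refl
        ; capped = λ _ x i≤x x≤i → ≤-trans (≤-reflexive (cong l (≤-antisym x≤i i≤x))) (m≤m+n _ _)
        ; monotone = λ _ x z i≤x x≤z z≤i → ≤-reflexive (cong l (≤-antisym x≤z (≤-trans z≤i i≤x))) }
      shape {i = i} {a = a} a+p≤y (left e e′ d) with shapeDrop a+p≤y d
      ... | S , f≤a =
        peeled-left e e′ (m≤m+n a _) a+p≤y (rangeDrop d) ≤-refl f≤a
          (≤-trans (firstDrop d) (m+n≤o⇒m≤o a a+p≤y)) (aboveDrop d)
          valley′ (let x , p , q , r = S .floor in x , <⇒≤ p , q , r) (λ ()) S
        where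
        valley′ : ∀ y z → i < y → y < z → z ≤ _ → l y ≤ a ⊎ l y ≤ l z
        valley′ y z i<y y<z z≤j with m≤n⇒m<n∨m≡n i<y
        ... | inj₂ refl = inj₁ (firstDrop d)
        ... | inj₁ i<y′ with S .ascending .valley (suc i) y z ≤-refl i<y′ y<z z≤j
        ...   | inj₁ q = inj₁ (≤-trans q (firstDrop d))
        ...   | inj₂ q = inj₂ q
      shape {φ} {p = p} a+p≤y (turn {x = x} {x< = x<} {a = a} {b} e e′ b+x c) =
        peeled-left e e′ (m≤m+n a _) a+p≤y (range c) a≤b ≤-refl
          (≤-trans (≤-reflexive (first c)) b≤y) (above c)
          (λ y z i<y y<z z≤j → inj₂ (S .monotone refl y z i<y (<⇒≤ y<z) z≤j))
          (_ , ≤-refl , <⇒≤ (range c) , e)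
          (λ _ → refl , ≤-trans a≤b (≤-reflexive (sym (first c))))
          S
        where
        a≤b : a ≤ b
        a≤b = +-cancelʳ-≤ x a b (≤-trans (+-monoʳ-≤ a (turnRange-≤ φ x<)) (≤-reflexive (sym b+x)))
        b+x≤y : b + x ≤ _
        b+x≤y = ≤-trans (≤-reflexive b+x) a+p≤y
        b≤y : b ≤ _
        b≤y = m+n≤o⇒m≤o b b+x≤y
        S : Shape l u rising _ _ _ b _ (a + p)
        S = reshape b+x (shape b+x≤y c)
      shape a+p≤y (high c) = shape⁺ a+p≤y c

      shape⁺ : ∀ {φ β p n} {c : Code⁺ φ β p n} {i j f t a y} → a + p ≤ y →
        Fits⁺ l u c i j f t a y → Shape l u φ β i j f t (a + p)
      shape⁺ {β = β} {a = a} a+p≤y (up c) = lowered β (shape (raise-bound β {a} a+p≤y) c)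
      shape⁺ {a = a} a+p≤y (right {x = x} {x≤ = x≤} e e′ c) =
        peeled-right (range⁺ c) (first⁺ c) (m≤m+n a x) e e′ a+x≤y (+-monoʳ-≤ a (s≤s⁻¹ x≤)) (above⁺ c) (shape⁺ a+x≤y c)
        where
        a+x≤y : a + x ≤ _
        a+x≤y = ≤-trans (+-monoʳ-≤ a (s≤s⁻¹ x≤)) a+p≤y

      shapeDrop : ∀ {β p n} {d : Drop β p n} {i j f t a y} → a + p ≤ y →
        FitsDrop l u d i j f t a y → Shape l u falling β i j f t (a + p) × f ≤ a
      shapeDrop a+p≤y (stay c) = S , ≤-trans (S .floor≤ _ ≤-refl (range c)) (≤-reflexive (first c))
        where S = shape a+p≤y c
      shapeDrop {p = p} {a = suc a} a+p≤y (down d) with shapeDrop (≤-trans (≤-reflexive (+-suc a p)) a+p≤y) d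
      ... | S , f≤a = reshape (+-suc a p) S , m≤n⇒m≤1+n f≤a

    -- y is the current height and z the lower end of the last column.
    Capped : Bound → (b y z : ℕ) → Set
    Capped level b y z = b ≡ y
    Capped fixed b y z = z ≤ b × b ≤ y

    Monotone : Phase → ℕ → ℕ → Set
    Monotone falling i j = ⊤
    Monotone rising  i j = ∀ x z → i ≤ x → x ≤ z → z ≤ j → l x ≤ l z

    drops : ∀ k {β p q n a a′ i j f t y} {c : Code falling β q n} → q ≡ k + p → a′ ≡ k + a →
      Fits l u c i j f t a y → Σ ℕ λ n′ → Σ (Drop β p n′) λ d → FitsDrop l u d i j f t a′ y
    drops zero refl refl c = _ , _ , stay c
    drops (suc k) {p = p} q≡ refl c with drops k {p = suc p} (trans q≡ (sym (+-suc k p))) refl c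
    ... | _ , _ , d = _ , _ , down d

    Fitting : Phase → Bound → (p i j y : ℕ) → Set
    Fitting φ β p i j y =
      Σ ℕ λ n → Σ (Code φ β p n) λ c → Σ ℕ λ f → Σ ℕ λ t → Fits l u c i j f t (l i) y

    Fitting⁺ : Phase → Bound → (p i j y : ℕ) → Set
    Fitting⁺ φ β p i j y =
      Σ ℕ λ n → Σ (Code⁺ φ β p n) λ c → Σ ℕ λ f → Σ ℕ λ t → Fits⁺ l u c i j f t (l i) y

    floor-rising : ∀ {β p n} {c : Code rising β p n} {i j f t a y} → Fits l u c i j f t a y → f ≡ a
    floor-rising⁺ : ∀ {β p n} {c : Code⁺ rising β p n} {i j f t a y} → Fits⁺ l u c i j f t a y → f ≡ a
    floor-rising (last _ _) = refl
    floor-rising (turn _ _ _ _) = refl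
    floor-rising (high c) = floor-rising⁺ c
    floor-rising⁺ (up c) = floor-rising c
    floor-rising⁺ (right _ _ c) = floor-rising⁺ c

    drop-fitting : ∀ {β p p′ i j y} → u i ≡ y → l (suc i) ≤ l i → p′ ≡ (l i ∸ l (suc i)) + p →
      Fitting falling β p′ (suc i) j y → Fitting falling β p i j y
    drop-fitting {i = i} u≡y l′≤l p′≡ (_ , _ , _ , _ , c) 
      with drops (l i ∸ l (suc i)) p′≡ (sym (m∸n+n≡m l′≤l)) c
    ... | _ , _ , d = _ , _ , _ , _ , left refl u≡y d

    turn-fitting : ∀ {φ β p x i j y} → u i ≡ y → x < turnRange φ p → l (suc i) + x ≡ l i + p →
      Fitting rising β x (suc i) j y → Fitting φ β p i j y
    turn-fitting u≡y x< l+x (_ , _ , _ , _ , c) with refl ← floor-rising c = _ , _ , _ , _ , turn {x< = x<} refl u≡y l+x c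

    -- After a strict rise of the lower end, the valley condition forces it to be monotone.
    rise⇒monotone : ∀ {i j} → Ascending l u i j → l i < l (suc i) → Monotone rising (suc i) j
    rise⇒monotone {i} A l<l′ x z i<x x≤z z≤j with m≤n⇒m<n∨m≡n x≤z
    ... | inj₂ refl = ≤-refl
    ... | inj₁ x<z with A .valley i x z ≤-refl i<x x<z z≤j
    ...   | inj₂ lx≤lz = lx≤lz
    ...   | inj₁ lx≤li with m≤n⇒m<n∨m≡n i<x
    ...     | inj₂ refl = contradiction lx≤li (<⇒≱ l<l′)
    ...     | inj₁ i<x′ with A .valley i (suc i) x ≤-refl ≤-refl i<x′ (≤-trans x≤z z≤j)
    ...       | inj₁ q = contradiction q (<⇒≱ l<l′)
    ...       | inj₂ q = contradiction (≤-trans q lx≤li) (<⇒≱ l<l′)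

    next-above : ∀ {i j} → Ascending l u i j → i < j → u i ≤ u j → u i ≤ u (suc i)
    next-above {i} A i<j q with m≤n⇒m<n∨m≡n i<j
    ... | inj₂ refl = q
    ... | inj₁ i<j′ with A .unimodal i (suc i) _ ≤-refl ≤-refl i<j′ ≤-refl
    ...   | inj₁ r = r
    ...   | inj₂ r = ≤-trans q r

    next-below-cap : ∀ β {i j b} → Ascending l u i j → i < j → Capped β b (u i) (l j) →
      Monotone rising (suc i) j → l (suc i) ≤ b
    next-below-cap level A i<j refl _ = proj₁ (A .adjacent _ ≤-refl i<j)
    next-below-cap fixed A i<j (lj≤b , _) mono = ≤-trans (mono _ _ ≤-refl i<j ≤-refl) lj≤b

    bound-up : ∀ β {a p y z} → Capped β (a + p) y z → Capped β (a + raise β p) (suc y) z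
    bound-up level {a} {p} e = trans (+-suc a p) (cong suc e)
    bound-up fixed (q , r) = q , m≤n⇒m≤1+n r

    bound-last : ∀ β {b y j} → l j ≤ u j → u j ≤ y → Capped β b y (l j) → l j ≤ b
    bound-last level q r refl = ≤-trans q r
    bound-last fixed q r (s , _) = s

    monotone-restrict : ∀ φ {i j j′} → j′ ≤ j → Monotone φ i j → Monotone φ i j′
    monotone-restrict falling _ _ = _
    monotone-restrict rising q mono x z i≤x x≤z z≤j = mono x z i≤x x≤z (≤-trans z≤j q)

    -- Comparability enters the encoding here: it makes the offset of a column removed on the right
    -- a natural number, and through the valley condition it turns that column into a cap for its
    -- predecessors.
    ends-below : ∀ {i j} → Ascending l u i (suc j) → i ≤ j → u (suc j) < u i → l i ≤ l (suc j)
    ends-below A i≤j u< with A .comparable _ _ ≤-refl (s≤s i≤j) ≤-refl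
    ... | inj₁ q = contradiction q (<⇒≱ u<)
    ... | inj₂ q = q

    prev-above : ∀ {i j} → Ascending l u i (suc j) → i ≤ j → u (suc j) < u i → u (suc j) ≤ u j
    prev-above A i≤j u< with m≤n⇒m<n∨m≡n i≤j
    ... | inj₂ refl = <⇒≤ u<
    ... | inj₁ i<j with A .unimodal _ _ _ ≤-refl i<j ≤-refl ≤-refl
    ...   | inj₁ q = ≤-trans (<⇒≤ u<) q
    ...   | inj₂ q = q

    prev-below : ∀ {i j} → Ascending l u i (suc j) → i ≤ j → u (suc j) < u i → l j ≤ l (suc j)
    prev-below A i≤j u< with m≤n⇒m<n∨m≡n i≤j
    ... | inj₂ refl = ends-below A i≤j u<
    ... | inj₁ i<j with A .valley _ _ _ ≤-refl i<j ≤-refl ≤-refl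
    ...   | inj₁ q = ≤-trans q (ends-below A i≤j u<)
    ...   | inj₂ q = q

    -- Completeness, by lexicographic induction on the number m of columns after the first and the
    -- excess e of the first upper end over the height. By unimodality, y below both outer upper
    -- ends means y below all of them, so peeling at the two ends misses nothing.
    fitting : ∀ m e φ β {p i j y} → i + m ≡ j → y + e ≡ u i → y ≤ u j → Ascending l u i j →
      Capped β (l i + p) y (l j) → Monotone φ i j → Fitting φ β p i j y
    fitting-left : ∀ m φ β {p i j} → suc i + m ≡ j → u i ≤ u j → Ascending l u i j →
      Capped β (l i + p) (u i) (l j) → Monotone φ i j → Fitting φ β p i j (u i)
    fitting-turn : ∀ m {φ} β {p i j} → suc i + m ≡ j → u i ≤ u j → Ascending l u i j →
      Capped β (l i + p) (u i) (l j) → Monotone rising (suc i) j →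
      (∀ x → l (suc i) + x ≡ l i + p → x < turnRange φ p) → Fitting φ β p i j (u i)
    fitting-high : ∀ m e φ β {p i j y} → i + m ≡ j → suc y + e ≡ u i → y ≤ u j → Ascending l u i j →
      Capped β (l i + p) y (l j) → Monotone φ i j → Fitting⁺ φ β p i j y
    fitting-right : ∀ m e φ β {p i j y} → i + m ≡ j → suc y + e ≡ u i → u j ≡ y → Ascending l u i j →
      Capped β (l i + p) y (l j) → Monotone φ i j → Fitting⁺ φ β p i j y

    fitting zero zero φ β {i = i} i+m e _ A cap mono with refl ← trans (sym (+-identityʳ i)) i+m =
      _ , last , _ , _ , last refl (trans (sym e) (+-identityʳ _))
    fitting (suc m) zero φ β {i = i} refl e y≤ A cap mono with refl ← trans (sym (+-identityʳ _)) e =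
      fitting-left m φ β (sym (+-suc i m)) y≤ A cap mono
    fitting m (suc e) φ β refl q y≤ A cap mono
      with fitting-high m e φ β refl (trans (sym (+-suc _ e)) q) y≤ A cap mono
    ... | _ , _ , _ , _ , c = _ , _ , _ , _ , high c

    fitting-left m falling β {p} {i} refl y≤ A cap mono with ≤-<-connex (l (suc i)) (l i)
    ... | inj₂ l<l′ =
      fitting-turn m β refl y≤ A cap (rise⇒monotone A l<l′) λ x q → +-cancelˡ-< (l i) x p
        (≤-trans (+-monoˡ-< x l<l′) (≤-reflexive q))
    ... | inj₁ l′≤l = drop-fitting refl l′≤l refl
      (fitting m (u (suc i) ∸ u i) falling β refl (m+[n∸m]≡n (next-above A (s≤s (m≤m+n i m)) y≤)) y≤
        (restrict (n≤1+n i) ≤-refl A) (subst (λ b → Capped β b (u i) (l (suc i + m))) same cap) _)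
      where
      same : l i + p ≡ l (suc i) + (l i ∸ l (suc i) + p)
      same = trans (cong (_+ p) (sym (m+[n∸m]≡n l′≤l))) (+-assoc (l (suc i)) _ p)
    fitting-left m rising β {p} {i} refl y≤ A cap mono =
      fitting-turn m β refl y≤ A cap (λ x z i<x → mono x z (<⇒≤ i<x)) λ x q →
        s≤s (+-cancelˡ-≤ (l i) x p (≤-trans (+-monoˡ-≤ x (mono i (suc i) ≤-refl (n≤1+n i) (s≤s (m≤m+n i m)))) (≤-reflexive q)))

    fitting-turn m {φ} β {p} {i} refl y≤ A cap mono x< =
      turn-fitting refl (x< x same) same
        (fitting m (u (suc i) ∸ u i) rising β refl (m+[n∸m]≡n (next-above A (s≤s (m≤m+n i m)) y≤)) y≤
          (restrict (n≤1+n i) ≤-refl A) (subst (λ b → Capped β b (u i) (l (suc i + m))) (sym same) cap) mono)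
      where
      -- The bound stays where it is; only its distance to the new first lower end is recomputed.
      x = l i + p ∸ l (suc i)
      same : l (suc i) + x ≡ l i + p
      same = m+[n∸m]≡n (next-below-cap β A (s≤s (m≤m+n i m)) cap mono)

    fitting-high m e φ β {y = y} refl q y≤ A cap mono with m≤n⇒m<n∨m≡n y≤
    ... | inj₂ y≡ = fitting-right m e φ β refl q (sym y≡) A cap mono
    ... | inj₁ y< with fitting m e φ β refl q y< A (bound-up β cap) mono
    ...   | _ , _ , _ , _ , c = _ , _ , _ , _ , up c

    fitting-right zero e φ β {i = i} {y = y} refl q r A cap mono =
      -- A single remaining column would have upper end `y` and yet be higher than `y`.
      contradiction (trans (sym r) (trans (cong u (+-identityʳ i)) (sym q))) (<⇒≢ (s≤s (m≤m+n y e)))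
    fitting-right (suc m) e φ β {p} {i} {y = y} i+m q refl A cap mono
      with refl ← trans (sym (+-suc i m)) i+m = peel (fitting-high m e φ fixed refl q (prev-above A i≤ ui>)
        (restrict ≤-refl (n≤1+n _) A) (≤-trans (prev-below A i≤ ui>) (≤-reflexive (sym b≡)) , ≤-trans (≤-reflexive b≡) l≤u)
        (monotone-restrict φ (n≤1+n _) mono))
      where
      j = i + m
      i≤ : i ≤ j
      i≤ = m≤m+n i m
      ui> : u (suc j) < u i
      ui> = ≤-trans (s≤s (m≤m+n _ e)) (≤-reflexive q)
      l≤u : l (suc j) ≤ u (suc j)
      l≤u = A .nonempty (suc j) (m≤n⇒m≤1+n i≤) ≤-refl
      x = l (suc j) ∸ l i
      b≡ : l i + x ≡ l (suc j)
      b≡ = m+[n∸m]≡n (ends-below A i≤ ui>)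
      peel : Fitting⁺ φ fixed x i j y → Fitting⁺ φ β p i (suc j) y
      peel (_ , _ , _ , _ , c) =
        _ , right x (s≤s (+-cancelˡ-≤ (l i) x p (≤-trans (≤-reflexive b≡) (bound-last β l≤u ≤-refl cap)))) _ ,
        _ , _ , right (sym b≡) refl c

-- Connectedness, convexity and D_NW of a grid in terms of its columns.

module Grids where

  open Profiles
  open import Data.Nat using (ℕ; zero; suc; _+_; _∸_; _<_; _≤_; z≤n; s≤s; s≤s⁻¹; _⊔_)
  open import Data.Nat.Properties
  open import Data.List using (List; []; _∷_; replicate; _++_)
  open import Data.List.Properties using (++-identityʳ)
  open import Data.Product using (Σ; _×_; _,_; proj₁; proj₂)
  open import Data.Sum using (_⊎_; inj₁; inj₂)
  open import Data.Empty using (⊥; ⊥-elim)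
  open import Relation.Nullary using (contradiction)
  open import Relation.Binary.PropositionalEquality using (_≡_; refl; sym; trans; cong; subst)

  open Ascending

  source : ∀ {g a b} → Reach g a b → In g a
  source (here p)     = p
  source (step p _ _) = p

  reach-trans : ∀ {g a b c} → Reach g a b → Reach g b c → Reach g a c
  reach-trans (here _)     r = r
  reach-trans (step p q s) r = step p q (reach-trans s r)

  adj-sym : ∀ {a b} → Adj a b → Adj b a
  adj-sym east  = west
  adj-sym west  = east
  adj-sym north = south
  adj-sym south = north

  reach-sym : ∀ {g a b} → Reach g a b → Reach g b a
  reach-sym (here p)     = here p
  reach-sym (step p q s) = reach-trans (reach-sym s) (step (source s) (adj-sym q) (here p))

  -- Turns edge-connectedness into adjacency of neighbouring columns: some step of the path goes
  -- East from column k, and it exhibits a row common to both.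
  crossing : ∀ {g a b} k → Reach g a b → proj₁ a ≤ k → k < proj₁ b →
    Σ ℕ λ y → In g (k , y) × In g (suc k , y)
  crossing k (here _) a≤k k<b = contradiction k<b (≤⇒≯ a≤k)
  crossing k (step p east s) a≤k k<b with m≤n⇒m<n∨m≡n a≤k
  ... | inj₁ a<k  = crossing k s a<k k<b
  ... | inj₂ refl = _ , p , source s
  crossing k (step _ west s)  a≤k k<b = crossing k s (<⇒≤ a≤k) k<b
  crossing k (step _ north s) a≤k k<b = crossing k s a≤k k<b
  crossing k (step _ south s) a≤k k<b = crossing k s a≤k k<b

  path-source : ∀ {g a ds b} → NWPath g a ds b → In g a
  path-source (done p)    = p
  path-source (stepN p _) = p
  path-source (stepW p _) = p

  path-target : ∀ {g a ds b} → NWPath g a ds b → In g b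
  path-target (done p)    = p
  path-target (stepN _ r) = path-target r
  path-target (stepW _ r) = path-target r

  path-monotone : ∀ {g a ds b} → NWPath g a ds b → proj₁ b ≤ proj₁ a × proj₂ a ≤ proj₂ b
  path-monotone (done _)    = ≤-refl , ≤-refl
  path-monotone (stepN _ r) = let p , q = path-monotone r in p , <⇒≤ q
  path-monotone (stepW _ r) = let p , q = path-monotone r in m≤n⇒m≤1+n p , q

  path-empty : ∀ {g a b} → NWPath g a [] b → a ≡ b
  path-empty (done _) = refl

  straightN : ∀ {g a ds b} → NWPath g a (N ∷ ds) b → changes (N ∷ ds) ≡ 0 → proj₁ b ≡ proj₁ a
  straightN (stepN _ (done _))      _ = refl
  straightN (stepN _ r@(stepN _ _)) e = straightN r e

  straightW : ∀ {g a ds b} → NWPath g a (W ∷ ds) b → changes (W ∷ ds) ≡ 0 → proj₂ b ≡ proj₂ a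
  straightW (stepW _ (done _))      _ = refl
  straightW (stepW _ r@(stepW _ _)) e = straightW r e

  -- With at most one change, everything after the first West step runs due West in the row of the
  -- target, so the path passes through the north-east corner of the rectangle spanned by its ends.
  cornerN : ∀ {g a ds b} → NWPath g a (N ∷ ds) b → changes (N ∷ ds) ≤ 1 → In g (proj₁ a , proj₂ b)
  cornerN (stepN _ (done p))      _ = p
  cornerN (stepN _ r@(stepN _ _)) c = cornerN r c
  cornerN {g} (stepN _ r@(stepW p _)) c =
    subst (λ y → In g (_ , y)) (sym (straightW r (n≤0⇒n≡0 (s≤s⁻¹ c)))) p

  cornerW : ∀ {g a ds b} → NWPath g a (W ∷ ds) b → changes (W ∷ ds) ≤ 1 → In g (proj₁ b , proj₂ a)
  cornerW (stepW _ (done p))      _ = p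
  cornerW (stepW _ r@(stepW _ _)) c = cornerW r c
  cornerW {g} (stepW _ r@(stepN p _)) c =
    subst (λ x → In g (x , _)) (sym (straightN r (n≤0⇒n≡0 (s≤s⁻¹ c)))) p

  north-run : ∀ {g b ds} e {x y} → (∀ k → k ≤ e → In g (x , k + y)) →
    NWPath g (x , e + y) ds b → NWPath g (x , y) (replicate e N ++ ds) b
  north-run zero    _   r = r
  north-run {g} {b} {ds} (suc e) {x} {y} ins r =
    stepN (ins 0 z≤n) (north-run e (λ k k≤e → subst (λ z → In g (x , z)) (sym (+-suc k y)) (ins (suc k) (s≤s k≤e)))
      (subst (λ z → NWPath g (x , z) ds b) (sym (+-suc e y)) r))

  west-run : ∀ {g b ds} e {x y} → (∀ k → k ≤ e → In g (k + x , y)) →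
    NWPath g (x , y) ds b → NWPath g (e + x , y) (replicate e W ++ ds) b
  west-run zero    _   r = r
  west-run (suc e) ins r = stepW (ins (suc e) ≤-refl) (west-run e (λ k k≤e → ins k (m≤n⇒m≤1+n k≤e)) r)

  changes-const : ∀ d e → changes (replicate e d) ≡ 0
  changes-const d zero          = refl
  changes-const d (suc zero)    = refl
  changes-const N (suc (suc e)) = changes-const N (suc e)
  changes-const W (suc (suc e)) = changes-const W (suc e)

  changes-turn : ∀ c d e k → changes (replicate e c ++ replicate k d) ≤ 1
  changes-turn c d zero          k       = ≤-trans (≤-reflexive (changes-const d k)) z≤n
  changes-turn c d (suc zero)    zero    = z≤n
  changes-turn c d (suc zero)    (suc k) =
    ≤-trans (≤-reflexive (trans (cong (sameDir c d +_) (changes-const d (suc k))) (+-identityʳ _))) (sameDir≤1 c d)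
    where
    sameDir≤1 : ∀ c d → sameDir c d ≤ 1
    sameDir≤1 N N = z≤n
    sameDir≤1 W W = z≤n
    sameDir≤1 N W = ≤-refl
    sameDir≤1 W N = ≤-refl
  -- The directions are split because `sameDir c c` reduces to 0 only for a concrete c.
  changes-turn N d (suc (suc e)) k = changes-turn N d (suc e) k
  changes-turn W d (suc (suc e)) k = changes-turn W d (suc e) k

  record Columns (g : Grid) (l u : ℕ → ℕ) (j : ℕ) : Set where
    field
      cell   : ∀ {x y} → x ≤ j → l x ≤ y → y ≤ u x → In g (x , y)
      column : ∀ {x y} → In g (x , y) → x ≤ j × l x ≤ y × y ≤ u x

  open Columns

  module _ {g : Grid} {l u : ℕ → ℕ} {j : ℕ} (C : Columns g l u j) where

    module _ (A : Ascending l u 0 j) where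

      rise : ∀ {x y} e → x ≤ j → l x ≤ y → e + y ≤ u x → Reach g (x , y) (x , e + y)
      rise zero    x≤j l≤y y≤u = here (C .cell x≤j l≤y y≤u)
      rise {x} {y} (suc e) x≤j l≤y y≤u =
        step (C .cell x≤j l≤y (≤-trans (m≤n+m y (suc e)) y≤u)) north
          (subst (λ z → Reach g (x , suc y) (x , z)) (+-suc e y)
            (rise e x≤j (m≤n⇒m≤1+n l≤y) (≤-trans (≤-reflexive (+-suc e y)) y≤u)))

      vertical : ∀ {x y z} → x ≤ j → l x ≤ y → y ≤ z → z ≤ u x → Reach g (x , y) (x , z)
      vertical {x} {y} {z} x≤j l≤y y≤z z≤u =
        subst (λ k → Reach g (x , y) (x , k)) (m∸n+n≡m y≤z)
          (rise (z ∸ y) x≤j l≤y (≤-trans (≤-reflexive (m∸n+n≡m y≤z)) z≤u))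

      to-origin : ∀ x → x ≤ j → Reach g (x , l x) (0 , l 0)
      to-origin zero    x≤j = here (C .cell x≤j ≤-refl (A .nonempty 0 z≤n x≤j))
      to-origin (suc x) x<j =
        -- The row max (l x) (l (suc x)) belongs to both columns by adjacency; the path changes
        -- column there.
        reach-trans (vertical x<j ≤-refl (m≤n⊔m (l x) _) r≤u′)
          (step (C .cell x<j (m≤n⊔m (l x) _) r≤u′) west
            (reach-trans (reach-sym (vertical (<⇒≤ x<j) ≤-refl (m≤m⊔n _ _) r≤u)) (to-origin x (<⇒≤ x<j))))
        where
        adj  = A .adjacent x z≤n x<j
        r≤u′ : l x ⊔ l (suc x) ≤ u (suc x)
        r≤u′ = ⊔-lub (proj₂ adj) (A .nonempty (suc x) z≤n x<j)
        r≤u  : l x ⊔ l (suc x) ≤ u x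
        r≤u  = ⊔-lub (A .nonempty x z≤n (<⇒≤ x<j)) (proj₁ adj)

      connected : Connected g
      connected a b p q = reach-trans (origin p) (reach-sym (origin q))
        where
        origin : ∀ {c} → In g c → Reach g c (0 , l 0)
        origin p with C .column p
        ... | x≤j , l≤y , y≤u = reach-trans (reach-sym (vertical x≤j ≤-refl l≤y y≤u)) (to-origin _ x≤j)

      convex : Convex g
      convex = rows , λ x y₁ y y₂ p q y₁≤y y≤y₂ →
        let x≤j , l≤y₁ , _ = C .column p ; _ , _ , y₂≤u = C .column q in
        C .cell x≤j (≤-trans l≤y₁ y₁≤y) (≤-trans y≤y₂ y₂≤u)
        where
        rows : ∀ x₁ x x₂ y → In g (x₁ , y) → In g (x₂ , y) → x₁ ≤ x → x ≤ x₂ → In g (x , y)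
        rows x₁ x x₂ y p q x₁≤x x≤x₂ with m≤n⇒m<n∨m≡n x₁≤x | m≤n⇒m<n∨m≡n x≤x₂
        ... | inj₂ refl | _         = p
        ... | inj₁ _    | inj₂ refl = q
        ... | inj₁ x₁<x | inj₁ x<x₂ with C .column p | C .column q
        ...   | _ , l₁≤y , y≤u₁ | x₂≤j , l₂≤y , y≤u₂ = C .cell (≤-trans x≤x₂ x₂≤j) l≤y y≤u
          where
          l≤y : l x ≤ y
          l≤y with A .valley x₁ x x₂ z≤n x₁<x x<x₂ x₂≤j
          ... | inj₁ r = ≤-trans r l₁≤y
          ... | inj₂ r = ≤-trans r l₂≤y
          y≤u : y ≤ u x
          y≤u with A .unimodal x₁ x x₂ z≤n x₁<x x<x₂ x₂≤j
          ... | inj₁ r = ≤-trans y≤u₁ r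
          ... | inj₂ r = ≤-trans y≤u₂ r

      -- Comparability becomes D_NW ≤ 1 here: each of its two alternatives puts one of the missing
      -- corners of the rectangle inside the grid, and convexity then fills the two sides through
      -- it.
      corner : ∀ {x x′ y y′} → In g (x , y) → In g (x′ , y′) → x′ ≤ x → y ≤ y′ → In g (x , y′) ⊎ In g (x′ , y)
      corner p q x′≤x y≤y′ with m≤n⇒m<n∨m≡n x′≤x
      ... | inj₂ refl = inj₁ q
      ... | inj₁ x′<x with C .column p | C .column q
      ...   | x≤j , lx≤y , y≤ux | x′≤j , lx′≤y′ , y′≤ux′ with A .comparable _ _ z≤n x′<x x≤j
      ...     | inj₁ r = inj₁ (C .cell x≤j (≤-trans lx≤y y≤y′) (≤-trans y′≤ux′ r))
      ...     | inj₂ r = inj₂ (C .cell x′≤j (≤-trans r lx≤y) (≤-trans y≤y′ y′≤ux′))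

      between : ∀ {k e m n} → k ≤ e → m ≤ n → n ∸ m ≡ e → m ≤ k + m × k + m ≤ n
      between {k} {e} {m} k≤e m≤n refl =
        m≤n+m m k , ≤-trans (+-monoˡ-≤ m k≤e) (≤-reflexive (m∸n+n≡m m≤n))

      atMostOne : NWAtMostOne g
      atMostOne (x , y) (x′ , y′) ds path = go (corner p q x′≤x y≤y′)
        where
        p = path-source path
        q = path-target path
        x′≤x = proj₁ (path-monotone path)
        y≤y′ = proj₂ (path-monotone path)
        e = y′ ∸ y
        d = x ∸ x′
        ups : ∀ {z} → In g (z , y) → In g (z , y′) → ∀ k → k ≤ e → In g (z , k + y)
        ups r s k k≤e = let a , b = between k≤e y≤y′ refl in proj₂ convex _ _ _ _ r s a b
        wests : ∀ {z} → In g (x′ , z) → In g (x , z) → ∀ k → k ≤ d → In g (k + x′ , z)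
        wests r s k k≤d = let a , b = between k≤d x′≤x refl in proj₁ convex _ _ _ _ r s a b
        go : In g (x , y′) ⊎ In g (x′ , y) → Σ (List Dir) λ es → NWPath g (x , y) es (x′ , y′) × changes es ≤ 1
        go (inj₁ r) = replicate e N ++ replicate d W ++ [] ,
          north-run e (ups p r) (subst (λ k → NWPath g (x , k) (replicate d W ++ []) (x′ , y′)) (sym (m∸n+n≡m y≤y′))
            (subst (λ k → NWPath g (k , y′) (replicate d W ++ []) (x′ , y′)) (m∸n+n≡m x′≤x) (west-run d (wests q r) (done q)))) ,
          subst (λ zs → changes (replicate e N ++ zs) ≤ 1) (sym (++-identityʳ _)) (changes-turn N W e d)
        go (inj₂ r) = replicate d W ++ replicate e N ++ [] ,
          subst (λ k → NWPath g (k , y) (replicate d W ++ replicate e N ++ []) (x′ , y′)) (m∸n+n≡m x′≤x)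
            (west-run d (wests r p) (north-run e (ups r q)
              (subst (λ k → NWPath g (x′ , k) [] (x′ , y′)) (sym (m∸n+n≡m y≤y′)) (done q)))) ,
          subst (λ zs → changes (replicate d W ++ zs) ≤ 1) (sym (++-identityʳ _)) (changes-turn W N d e)

    module _ (cross : ∀ x → x < j → Σ ℕ λ y → In g (x , y) × In g (suc x , y))
             (inhabited : ∀ x → x ≤ j → l x ≤ u x)
             (convex : Convex g) (atMostOne : NWAtMostOne g) where

      adjacent′ : ∀ x → x < j → l (suc x) ≤ u x × l x ≤ u (suc x)
      adjacent′ x x<j with cross x x<j
      ... | y , p , q with C .column p | C .column q
      ...   | _ , l≤y , y≤u | _ , l′≤y , y≤u′ = ≤-trans l′≤y y≤u , ≤-trans l≤y y≤u′

      -- A row above u y that is reached on both sides of column y would meet column y by row convexity.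
      reach-up-left : ∀ d {x y} → x + d ≡ y → y ≤ j → u y < u x → Σ ℕ λ z → z ≤ y × In g (z , suc (u y))
      reach-up-left zero {x} refl y≤j u< = contradiction u< (<-irrefl (cong u (+-identityʳ x)))
      reach-up-left (suc d) {x} {y} e y≤j u< with ≤-<-connex (l x) (suc (u y))
      ... | inj₁ l≤ = x , <⇒≤ x<y , C .cell (≤-trans (<⇒≤ x<y) y≤j) l≤ u<
        where x<y = ≤-trans (s≤s (m≤m+n x d)) (≤-reflexive (trans (sym (+-suc x d)) e))
      ... | inj₂ <l = reach-up-left d (trans (sym (+-suc x d)) e) y≤j
                        (≤-trans (<⇒≤ <l) (proj₂ (adjacent′ x (≤-trans x<y y≤j))))
        where x<y = ≤-trans (s≤s (m≤m+n x d)) (≤-reflexive (trans (sym (+-suc x d)) e))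

      reach-up-right : ∀ d {y} → d + y ≤ j → u y < u (d + y) → Σ ℕ λ z → y ≤ z × In g (z , suc (u y))
      reach-up-right zero y≤j u< = contradiction u< (<-irrefl refl)
      reach-up-right (suc d) {y} z≤j u< with ≤-<-connex (l (suc d + y)) (suc (u y))
      ... | inj₁ l≤ = suc d + y , m≤n+m y (suc d) , C .cell z≤j l≤ u<
      ... | inj₂ <l = reach-up-right d (<⇒≤ z≤j) (≤-trans (<⇒≤ <l) (proj₁ (adjacent′ (d + y) z≤j)))

      -- A column that misses row `r` lies wholly below it; by adjacency the next lower end is then
      -- below `r` too, and the search moves on. It cannot arrive at `y` without a hit, because r <
      -- l y.
      reach-down-left : ∀ d {x y r} → x + d ≡ y → y ≤ j → l x ≤ r → r < l y → Σ ℕ λ z → z ≤ y × In g (z , r)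
      reach-down-left zero {x} refl y≤j l≤ r< = contradiction (≤-trans r< (≤-reflexive (cong l (+-identityʳ x)))) (≤⇒≯ l≤)
      reach-down-left (suc d) {x} {y} {r} e y≤j l≤ r< with ≤-<-connex r (u x)
      ... | inj₁ ≤u = x , <⇒≤ x<y , C .cell (≤-trans (<⇒≤ x<y) y≤j) l≤ ≤u
        where x<y = ≤-trans (s≤s (m≤m+n x d)) (≤-reflexive (trans (sym (+-suc x d)) e))
      ... | inj₂ u< = reach-down-left d (trans (sym (+-suc x d)) e) y≤j
                        (≤-trans (proj₁ (adjacent′ x (≤-trans x<y y≤j))) (<⇒≤ u<)) r<
        where x<y = ≤-trans (s≤s (m≤m+n x d)) (≤-reflexive (trans (sym (+-suc x d)) e))

      reach-down-right : ∀ d {y r} → d + y ≤ j → l (d + y) ≤ r → r < l y → Σ ℕ λ z → y ≤ z × In g (z , r)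
      reach-down-right zero y≤j l≤ r< = contradiction r< (≤⇒≯ l≤)
      reach-down-right (suc d) {y} {r} z≤j l≤ r< with ≤-<-connex r (u (suc d + y))
      ... | inj₁ ≤u = suc d + y , m≤n+m y (suc d) , C .cell z≤j l≤ ≤u
      ... | inj₂ u< = reach-down-right d (<⇒≤ z≤j) (≤-trans (proj₂ (adjacent′ (d + y) z≤j)) (<⇒≤ u<)) r<

      unimodal′ : ∀ x y z → x < y → y < z → z ≤ j → u x ≤ u y ⊎ u z ≤ u y
      unimodal′ x y z x<y y<z z≤j with ≤-<-connex (u x) (u y) | ≤-<-connex (u z) (u y)
      ... | inj₁ p | _      = inj₁ p
      ... | inj₂ _ | inj₁ q = inj₂ q
      ... | inj₂ p | inj₂ q
        with reach-up-left (y ∸ x) (m+[n∸m]≡n (<⇒≤ x<y)) (≤-trans (<⇒≤ y<z) z≤j) p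
           | reach-up-right (z ∸ y) (≤-trans (≤-reflexive y+) z≤j) (subst (λ k → u y < u k) (sym y+) q)
        where y+ = m∸n+n≡m (<⇒≤ y<z)
      ... | a , a≤y , r | b , y≤b , s =
        contradiction (proj₂ (proj₂ (C .column (proj₁ convex a y b _ r s a≤y y≤b)))) (<-irrefl refl)

      valley′ : ∀ x y z → x < y → y < z → z ≤ j → l y ≤ l x ⊎ l y ≤ l z
      valley′ x y z x<y y<z z≤j with ≤-<-connex (l y) (l x) | ≤-<-connex (l y) (l z)
      ... | inj₁ p | _      = inj₁ p
      ... | inj₂ _ | inj₁ q = inj₂ q
      ... | inj₂ p | inj₂ q = ⊥-elim (below (l y) refl)
        where
        y+ = m∸n+n≡m (<⇒≤ y<z)
        -- The row just under column `y` must be named, so `l y` is split: it is positive since l x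
        -- < l y.
        below : ∀ k → l y ≡ k → ⊥
        below zero    e = contradiction (≤-trans p (≤-reflexive e)) (λ ())
        below (suc k) e
          with reach-down-left (y ∸ x) (m+[n∸m]≡n (<⇒≤ x<y)) (≤-trans (<⇒≤ y<z) z≤j)
                 (s≤s⁻¹ (≤-trans p (≤-reflexive e))) (≤-reflexive (sym e))
             | reach-down-right (z ∸ y) (≤-trans (≤-reflexive y+) z≤j)
                 (s≤s⁻¹ (≤-trans (≤-reflexive (cong (λ m → suc (l m)) y+)) (≤-trans q (≤-reflexive e)))) (≤-reflexive (sym e))
        ... | a , a≤y , r | b , y≤b , s =
          contradiction (proj₁ (proj₂ (C .column (proj₁ convex a y b _ r s a≤y y≤b)))) (<⇒≱ (≤-reflexive (sym e)))

      climb : ∀ {x v w b} → v ≤ w → l x ≤ v → x ≤ j → (Σ (List Dir) λ ds → NWPath g (x , w) ds b) →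
        Σ (List Dir) λ ds → NWPath g (x , v) ds b
      climb {x} {v} {w} {b} v≤w l≤v x≤j (ds , r) =
        _ , north-run (w ∸ v) inside (subst (λ k → NWPath g (x , k) ds b) (sym (m∸n+n≡m v≤w)) r)
        where
        inside : ∀ k → k ≤ w ∸ v → In g (x , k + v)
        inside k k≤ = C .cell x≤j (≤-trans l≤v (m≤n+m v k))
          (≤-trans (≤-trans (+-monoˡ-≤ v k≤) (≤-reflexive (m∸n+n≡m v≤w))) (proj₂ (proj₂ (C .column (path-source r)))))

      -- Going West along the lowest admissible row stays below every upper end, since l k ≤ l x′ or l k ≤ l y.
      descend : ∀ {x y} → y ≤ j → x < y → u y < u x → ∀ d {k v} → d + x ≡ k → k ≤ y → l k ≤ v →
        (∀ z → x ≤ z → z ≤ k → v ≤ u z) → Σ (List Dir) λ ds → NWPath g (k , v) ds (x , u x)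
      descend {x} y≤j x<y u< zero refl x≤y l≤v v≤ =
        climb (v≤ x ≤-refl ≤-refl) l≤v x≤j (_ , done (C .cell x≤j (inhabited x x≤j) ≤-refl))
        where x≤j = ≤-trans (<⇒≤ x<y) y≤j
      descend {x} {y} y≤j x<y u< (suc d) {v = v} refl k≤y l≤v v≤ =
        climb (m≤m⊔n v (l k)) l≤v (≤-trans k≤y y≤j)
          (_ , stepW (C .cell (≤-trans k≤y y≤j) (≤-trans l≤v (m≤m⊔n v _))
            (⊔-lub (v≤ (suc k) (m≤n+m x (suc d)) ≤-refl) (proj₂ (adjacent′ k k<j)))) (proj₂ rest))
        where
        k = d + x
        k<j : k < j
        k<j = ≤-trans k≤y y≤j
        ends≤ : ∀ z → x ≤ z → z ≤ k → u y ≤ u z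
        ends≤ z x≤z z≤k with m≤n⇒m<n∨m≡n x≤z
        ... | inj₂ refl = <⇒≤ u<
        ... | inj₁ x<z with unimodal′ x z y x<z (≤-trans (s≤s z≤k) k≤y) y≤j
        ...   | inj₁ r = ≤-trans (<⇒≤ u<) r
        ...   | inj₂ r = r
        l≤ : ∀ z → x ≤ z → z ≤ k → l k ≤ u z
        l≤ z x≤z z≤k with m≤n⇒m<n∨m≡n z≤k
        ... | inj₂ refl = inhabited z (<⇒≤ k<j)
        ... | inj₁ z<k with valley′ z k y z<k k≤y y≤j
        ...   | inj₁ r = ≤-trans r (inhabited z (≤-trans z≤k (<⇒≤ k<j)))
        ...   | inj₂ r = ≤-trans r (≤-trans (inhabited y y≤j) (ends≤ z x≤z z≤k))
        rest : Σ (List Dir) λ ds → NWPath g (k , v ⊔ l k) ds (x , u x)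
        rest = descend y≤j x<y u< d refl (<⇒≤ k≤y) (m≤n⊔m v _)
          (λ z x≤z z≤k → ⊔-lub (v≤ z x≤z (m≤n⇒m≤1+n z≤k)) (l≤ z x≤z z≤k))

      -- If both alternatives fail, `descend` still joins (y , l y) to (x , u x) by a NW-path. A
      -- path with at most one change would need the corner (y , u x), above column y, or the corner
      -- (x , l y), below column x.
      comparable′ : ∀ x y → x < y → y ≤ j → u x ≤ u y ⊎ l x ≤ l y
      comparable′ x y x<y y≤j with ≤-<-connex (u x) (u y) | ≤-<-connex (l x) (l y)
      ... | inj₁ p | _      = inj₁ p
      ... | inj₂ _ | inj₁ q = inj₂ q
      ... | inj₂ p | inj₂ q with descend y≤j x<y p (y ∸ x) (m∸n+n≡m (<⇒≤ x<y)) ≤-refl ≤-refl low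
        where
        low : ∀ z → x ≤ z → z ≤ y → l y ≤ u z
        low z x≤z z≤y with m≤n⇒m<n∨m≡n x≤z | m≤n⇒m<n∨m≡n z≤y
        ... | inj₂ refl | _         = ≤-trans (<⇒≤ q) (inhabited x (≤-trans z≤y y≤j))
        ... | inj₁ _    | inj₂ refl = inhabited y y≤j
        ... | inj₁ x<z  | inj₁ z<y with unimodal′ x z y x<z z<y y≤j
        ...   | inj₁ r = ≤-trans (inhabited y y≤j) (≤-trans (<⇒≤ p) r)
        ...   | inj₂ r = ≤-trans (inhabited y y≤j) r
      ...   | ds , path with atMostOne _ _ ds path
      ...     | []     , r , _ = contradiction x<y (<-irrefl (cong proj₁ (sym (path-empty r))))
      ...     | N ∷ es , r , c = contradiction (proj₂ (proj₂ (C .column (cornerN r c)))) (<⇒≱ p)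
      ...     | W ∷ es , r , c = contradiction (proj₁ (proj₂ (C .column (cornerW r c)))) (<⇒≱ q)

      ascending′ : Ascending l u 0 j
      ascending′ = record
        { nonempty   = λ x _ → inhabited x
        ; adjacent   = λ x _ → adjacent′ x
        ; unimodal   = λ x y z _ → unimodal′ x y z
        ; valley     = λ x y z _ → valley′ x y z
        ; comparable = λ x y _ → comparable′ x y }

-- The bijection between codes and ascending polyominoes.

module Counting where

  open Codes
  open Matching
  open Profiles
  open Grids
  open import Data.Bool using (Bool; true; false; _∧_)
  open import Data.Bool.Properties using (T-∧; T-≡)
  import Data.Bool.Properties as Bool
  open import Data.Nat using (ℕ; zero; suc; _+_; _∸_; _<_; _≤_; z≤n; s≤s; s≤s⁻¹; _≤ᵇ_)
  open import Data.Nat.Properties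
  open import Data.Fin using (Fin; toℕ; fromℕ<)
  open import Data.Fin.Properties using (toℕ-fromℕ<; fromℕ<-toℕ; toℕ<n)
  open import Data.Vec using (Vec; lookup; tabulate)
  open import Data.Vec.Properties using (lookup∘tabulate; tabulate∘lookup; tabulate-cong)
  open import Data.List using ([]; map; allFin)
  open import Data.List.Properties using (length-map; length-tabulate)
  open import Data.List.Membership.Propositional using (_∈_)
  open import Data.List.Membership.Propositional.Properties using (∈-map⁺; ∈-map⁻; ∈-allFin)
  open import Data.List.Relation.Unary.Unique.Propositional using (Unique)
  import Data.List.Relation.Unary.Unique.Propositional.Properties as Unique
  open import Data.List.Relation.Unary.AllPairs using ([])
  open import Data.Product using (Σ; _×_; _,_; proj₁; proj₂)
  open import Data.Sum using (inj₁; inj₂)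
  open import Relation.Nullary using (¬_; Dec; contradiction; yes; no)
  open import Relation.Binary.PropositionalEquality using (_≡_; refl; sym; trans; cong; cong₂; subst; module ≡-Reasoning)
  open import Function using (_∘_; id)
  open import Function.Bundles using (Equivalence; Inverse; mk⇔)

  open Ascending
  open Columns
  open Shape

  within : ℕ → ℕ → ℕ → Bool
  within a b y = (a ≤ᵇ y) ∧ (y ≤ᵇ b)

  within⇒ : ∀ {a b y} → within a b y ≡ true → a ≤ y × y ≤ b
  within⇒ {a} {b} {y} e with Equivalence.to T-∧ (Equivalence.from T-≡ e)
  ... | p , q = ≤ᵇ⇒≤ a y p , ≤ᵇ⇒≤ y b q

  ⇒within : ∀ {a b y} → a ≤ y → y ≤ b → within a b y ≡ true
  ⇒within p q = Equivalence.to T-≡ (Equivalence.from T-∧ (≤⇒≤ᵇ p , ≤⇒≤ᵇ q))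

  fill : (w h : ℕ) (l u : ℕ → ℕ) → Grid
  fill w h l u = w , h , tabulate λ x → tabulate λ y → within (l (toℕ x)) (u (toℕ x)) (toℕ y)

  lookup-fill : ∀ {w h l u x y} (p : x < w) (q : y < h) →
    lookup (lookup (proj₂ (proj₂ (fill w h l u))) (fromℕ< p)) (fromℕ< q) ≡ within (l x) (u x) y
  lookup-fill {w} {h} {l} {u} {x} {y} p q = begin
    lookup (lookup (proj₂ (proj₂ (fill w h l u))) (fromℕ< p)) (fromℕ< q)
      ≡⟨ cong (λ r → lookup r (fromℕ< q)) (lookup∘tabulate {n = w} _ (fromℕ< p)) ⟩
    lookup (tabulate λ y → within (l (toℕ (fromℕ< p))) (u (toℕ (fromℕ< p))) (toℕ y)) (fromℕ< q)
      ≡⟨ lookup∘tabulate {n = h} _ (fromℕ< q) ⟩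
    within (l (toℕ (fromℕ< p))) (u (toℕ (fromℕ< p))) (toℕ (fromℕ< q))
      ≡⟨ cong₂ (λ k z → within (l k) (u k) z) (toℕ-fromℕ< p) (toℕ-fromℕ< q) ⟩
    within (l x) (u x) y ∎
    where open ≡-Reasoning

  fill-columns : ∀ {l u j t} → (∀ x → x ≤ j → u x ≤ t) → Columns (fill (suc j) (suc t) l u) l u j
  fill-columns {l} {u} {j} {t} u≤ .cell {x} {y} x≤j l≤y y≤u =
    s≤s x≤j , s≤s (≤-trans y≤u (u≤ x x≤j)) ,
    trans (lookup-fill {l = l} {u = u} (s≤s x≤j) (s≤s (≤-trans y≤u (u≤ x x≤j)))) (⇒within l≤y y≤u)
  fill-columns {l} {u} _ .column (p , q , e) = s≤s⁻¹ p , within⇒ (trans (sym (lookup-fill {l = l} {u = u} p q)) e)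

  vec-ext : ∀ {A : Set} {n} {v w : Vec A n} → (∀ i → lookup v i ≡ lookup w i) → v ≡ w
  vec-ext {v = v} {w} h = trans (sym (tabulate∘lookup v)) (trans (tabulate-cong h) (tabulate∘lookup w))

  bool-ext : ∀ {a b : Bool} → (a ≡ true → b ≡ true) → (b ≡ true → a ≡ true) → a ≡ b
  bool-ext {true}          f g = sym (f refl)
  bool-ext {false} {true}  f g = g refl
  bool-ext {false} {false} f g = refl

  grid-ext : ∀ {w h} {v v′ : Vec (Vec Bool h) w} →
    (∀ c → In (w , h , v) c → In (w , h , v′) c) → (∀ c → In (w , h , v′) c → In (w , h , v) c) → v ≡ v′
  grid-ext {w} {h} {v₁} {v₂} f g = vec-ext λ i → vec-ext λ k → bool-ext (at v₁ v₂ f i k) (at v₂ v₁ g i k)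
    where
    at : ∀ (v v′ : Vec (Vec Bool h) w) → (∀ c → In (w , h , v) c → In (w , h , v′) c) →
      ∀ i k → lookup (lookup v i) k ≡ true → lookup (lookup v′ i) k ≡ true
    at v v′ f i k e with f (toℕ i , toℕ k) (toℕ<n i , toℕ<n k ,
      trans (cong₂ (λ a b → lookup (lookup v a) b) (fromℕ<-toℕ i (toℕ<n i)) (fromℕ<-toℕ k (toℕ<n k))) e)
    ... | p , q , e′ =
      trans (sym (cong₂ (λ a b → lookup (lookup v′ a) b) (fromℕ<-toℕ i p) (fromℕ<-toℕ k q))) e′

  columns-unique : ∀ {g l u l′ u′ j} → Columns g l u j → Columns g l′ u′ j →
    (∀ x → x ≤ j → l x ≤ u x) → (∀ x → x ≤ j → l′ x ≤ u′ x) → ∀ x → x ≤ j → l x ≡ l′ x × u x ≡ u′ x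
  columns-unique {g} {l} {u} {l′} {u′} {j} C C′ ne ne′ x x≤j =
    ≤-antisym (lower C C′ ne′) (lower C′ C ne) , ≤-antisym (upper C′ C ne) (upper C C′ ne′)
    where
    lower : ∀ {l u l′ u′} → Columns g l u j → Columns g l′ u′ j → (∀ x → x ≤ j → l′ x ≤ u′ x) → l x ≤ l′ x
    lower C C′ ne′ = proj₁ (proj₂ (C .column (C′ .cell x≤j ≤-refl (ne′ x x≤j))))
    upper : ∀ {l u l′ u′} → Columns g l u j → Columns g l′ u′ j → (∀ x → x ≤ j → l′ x ≤ u′ x) → u′ x ≤ u x
    upper C C′ ne′ = proj₂ (proj₂ (C .column (C′ .cell x≤j (ne′ x x≤j) ≤-refl)))

  In? : ∀ g c → Dec (In g c)
  In? (w , h , v) (x , y) with x <? w | y <? h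
  ... | no x≮w  | _      = no λ (p , _) → x≮w p
  ... | yes _   | no y≮h = no λ (_ , q , _) → y≮h q
  ... | yes p   | yes q with lookup (lookup v (fromℕ< p)) (fromℕ< q) Bool.≟ true
  ...   | yes e = yes (p , q , e)
  ...   | no ¬e = no λ (_ , _ , e) → ¬e e

  least : ∀ {P : ℕ → Set} → (∀ y → Dec (P y)) → ∀ y → P y → Σ ℕ λ m → P m × ∀ z → P z → m ≤ z
  least P? zero p = zero , p , λ _ _ → z≤n
  least {P} P? (suc y) p with P? 0
  ... | yes q = 0 , q , λ _ _ → z≤n
  ... | no ¬q with least (P? ∘ suc) y p
  ...   | m , q , m≤ = suc m , q , λ { zero r → contradiction r ¬q ; (suc z) r → s≤s (m≤ z r) }

  greatest : ∀ {P : ℕ → Set} → (∀ y → Dec (P y)) → ∀ h → (∀ z → P z → z < h) → ∀ y → P y →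
    Σ ℕ λ m → P m × ∀ z → P z → z ≤ m
  greatest P? zero below y p = contradiction (below y p) (λ ())
  greatest P? (suc h) below y p with P? h
  ... | yes q = h , q , λ z r → s≤s⁻¹ (below z r)
  ... | no ¬q = greatest P? h (λ z r → ≤∧≢⇒< (s≤s⁻¹ (below z r)) λ { refl → ¬q r }) y p

  choose : ∀ {F : ℕ → ℕ → ℕ → Set} j → (∀ x → x ≤ j → Σ ℕ λ a → Σ ℕ (F x a)) →
    Σ (ℕ → ℕ) λ l → Σ (ℕ → ℕ) λ u → ∀ x → x ≤ j → F x (l x) (u x)
  choose {F} j f = proj₁ ∘ pick , proj₂ ∘ pick , spec
    where
    pick : ℕ → ℕ × ℕ
    pick x with x ≤? j
    ... | yes x≤j = let a , b , _ = f x x≤j in a , b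
    -- A dummy interval for columns beyond `j`, where nothing is claimed about the profile.
    ... | no _    = 0 , 0
    spec : ∀ x → x ≤ j → F x (proj₁ (pick x)) (proj₂ (pick x))
    spec x x≤j with x ≤? j
    ... | yes x≤j′ = proj₂ (proj₂ (f x x≤j′))
    ... | no x≰j   = contradiction x≤j x≰j

  record Profile (g : Grid) : Set where
    field
      {lo hi}   : ℕ → ℕ
      {j}       : ℕ
      width≡    : width g ≡ suc j
      columns   : Columns g lo hi j
      ascending : Ascending lo hi 0 j

  analyse : ∀ {n g} → IsAscending n g → Profile g
  analyse {g = zero , _ , _} (((_ , () , _) , _) , _)
  analyse {g = g@(suc j , h , v)} (((y₀ , p₀) , (y₁ , p₁) , _) , conn , conv , one , _) = record
    { width≡ = refl ; columns = C ; ascending = ascending′ C cross inhab conv one }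
    where
    cross : ∀ x → x < j → Σ ℕ λ y → In g (x , y) × In g (suc x , y)
    cross x x<j = crossing x (conn _ _ p₀ p₁) z≤n x<j
    somewhere : ∀ x → x ≤ j → Σ ℕ λ y → In g (x , y)
    somewhere x x≤j with m≤n⇒m<n∨m≡n x≤j
    ... | inj₁ x<j  = let y , p , _ = cross x x<j in y , p
    ... | inj₂ refl = y₁ , p₁
    Extent : ℕ → ℕ → ℕ → Set
    Extent x a b = In g (x , a) × In g (x , b) × ∀ y → In g (x , y) → a ≤ y × y ≤ b
    extent : ∀ x → x ≤ j → Σ ℕ λ a → Σ ℕ (Extent x a)
    extent x x≤j with somewhere x x≤j
    ... | y , p with least (λ y → In? g (x , y)) y p | greatest (λ y → In? g (x , y)) h (λ _ (_ , q , _) → q) y p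
    ...   | a , pa , a≤ | b , pb , ≤b = a , b , pa , pb , λ z q → a≤ z q , ≤b z q
    chosen = choose {Extent} j extent
    l = proj₁ chosen
    u = proj₁ (proj₂ chosen)
    spec = proj₂ (proj₂ chosen)
    C : Columns g l u j
    C .cell x≤j l≤y y≤u = let pa , pb , _ = spec _ x≤j in proj₂ conv _ _ _ _ pa pb l≤y y≤u
    C .column p@(x< , _) = s≤s⁻¹ x< , proj₂ (proj₂ (spec _ (s≤s⁻¹ x<))) _ p
    inhab : ∀ x → x ≤ j → l x ≤ u x
    inhab x x≤j = let pa , _ , b = spec x x≤j in proj₂ (b _ pa)

  -- The peeling starts at the lower end of the first column, so the bound `level` is at distance 0
  -- from it. With the floor normalised to 0, this initial height is the `depth` of the code.
  Whole : ℕ → Set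
  Whole n = Code falling level 0 n

  ProfileOf : ∀ {n} → Whole n → Set
  ProfileOf c = Profiled λ l u j t → Fits l u c 0 j 0 t (depth c) (depth c)

  profileOf : ∀ {n} (c : Whole n) → ProfileOf c
  profileOf c = profile c 0 0 (depth c) refl

  gridOf : ∀ {n} → Whole n → Grid
  gridOf c with profileOf c
  ... | l , u , j , t , _ = fill (suc j) (suc t) l u

  whole-shape : ∀ {n l u j f t a} {c : Whole n} → Fits l u c 0 j f t a a → Shape l u falling level 0 j f t (a + 0)
  whole-shape fits = shape (≤-reflexive (+-identityʳ _)) fits

  fill-ascending : ∀ {n l u j t a} {c : Whole n} → Fits l u c 0 j 0 t a a → IsAscending (suc n) (fill (suc j) (suc t) l u)
  fill-ascending {n} {l} {u} {j} {t} {a} fits =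
    ((l 0 , cell₀ 0 z≤n) , (l j , cell₀ j ≤-refl) ,
     (let x , _ , x≤j , e = S .floor in x , subst (λ y → In (fill (suc j) (suc t) l u) (x , y)) e (cell₀ x x≤j)) ,
     (let x , _ , x≤j , e = S .top in x , subst (λ y → In (fill (suc j) (suc t) l u) (x , y)) e (C .cell x≤j (A .nonempty x z≤n x≤j) ≤-refl))) ,
    connected C A , convex C A , atMostOne C A , size≡
    where
    S = whole-shape fits
    A = S .ascending
    C = fill-columns {l} {u} (λ x → S .≤top x z≤n)
    cell₀ : ∀ x → x ≤ j → In (fill (suc j) (suc t) l u) (x , l x)
    cell₀ x x≤j = C .cell x≤j ≤-refl (A .nonempty x z≤n x≤j)
    -- `size` yields n = j + 1 + t, while the rows 0 ... t number t + 1; the extra row accounts for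
    -- `suc n`.
    size≡ : suc j + suc t ≡ suc n
    size≡ = trans (+-suc (suc j) t) (cong suc (+-cancelʳ-≡ a (suc j + t) n (sym
      (trans (sym (trans (+-identityʳ _) (cong (_+ a) (+-identityʳ n)))) (size fits)))))


  fill-injective : ∀ {n l u j t a l′ u′ j′ t′ a′} {c c′ : Whole n} → Fits l u c 0 j 0 t a a → Fits l′ u′ c′ 0 j′ 0 t′ a′ a′ →
    fill (suc j) (suc t) l u ≡ fill (suc j′) (suc t′) l′ u′ → c ≡ c′
  fill-injective {l = l} {u} {j} {l′ = l′} {u′} {j′} fits fits′ e
    with refl ← suc-injective (cong width e) | refl ← suc-injective (cong height e) = same (agree 0 z≤n)
    where
    inhab : ∀ {n l u j f t a} {c : Whole n} → Fits l u c 0 j f t a a → ∀ x → x ≤ j → l x ≤ u x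
    inhab fits x = whole-shape fits .ascending .nonempty x z≤n
    agree : ∀ x → x ≤ j → l x ≡ l′ x × u x ≡ u′ x
    agree = columns-unique
      (subst (λ g → Columns g l u j) e (fill-columns {l} {u} (λ x → whole-shape fits .≤top x z≤n)))
      (fill-columns {l′} {u′} (λ x → whole-shape fits′ .≤top x z≤n))
      (inhab fits) (inhab fits′)
    same : l 0 ≡ l′ 0 × _ → _
    -- `unique` compares codes at a common height; both initial heights are the lower end of column
    -- 0, hence equal.
    same (l≡ , _) with refl ← trans (sym (first fits)) (trans l≡ (first fits′)) =
      unique (fits-local (λ x _ → agree x) fits) fits′

  gridOf-injective : ∀ {n} {c c′ : Whole n} → gridOf c ≡ gridOf c′ → c ≡ c′
  gridOf-injective {c = c} {c′} e with profileOf c | profileOf c′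
  ... | _ , _ , _ , _ , fits | _ , _ , _ , _ , fits′ = fill-injective fits fits′ e

  gridOf-ascending : ∀ {n} (c : Whole n) → IsAscending (suc n) (gridOf c)
  gridOf-ascending c with profileOf c
  ... | _ , _ , _ , _ , fits = fill-ascending fits

  record Agree (l u l′ u′ : ℕ → ℕ) (i j j′ t t′ a a′ : ℕ) : Set where
    constructor agree
    field
      j≡ : j ≡ j′
      t≡ : t ≡ t′
      a≡ : a ≡ a′
      pointwise : ∀ x → i ≤ x → x ≤ j → l x ≡ l′ x × u x ≡ u′ x

  module _ {l u l′ u′ : ℕ → ℕ} where
    agree-left : ∀ {i j j′ t t′ a a′ c c′} → l i ≡ c → l′ i ≡ c → u i ≡ u′ i → Agree l u l′ u′ (suc i) j j′ t t′ a a′ →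
      c ≡ c′ → Agree l u l′ u′ i j j′ t t′ c c′
    agree-left {i} {j} p q r (agree refl refl _ f) refl = agree refl refl refl g
      where
      g : ∀ x → i ≤ x → x ≤ j → l x ≡ l′ x × u x ≡ u′ x
      g x i≤x x≤j with m≤n⇒m<n∨m≡n i≤x
      ... | inj₁ i<x  = f x i<x x≤j
      ... | inj₂ refl = trans p (sym q) , r

    mutual
      -- Converse of `unique`: a code together with its floor and initial height determines the
      -- columns. It identifies the profile chosen by `profileOf` with the one read off a given
      -- grid.
      fits-agree : ∀ {φ β p n} {c : Code φ β p n} {i j j′ f t t′ a a′ y} →
        Fits l u c i j f t a y → Fits l′ u′ c i j′ f t′ a′ y → Agree l u l′ u′ i j j′ t t′ a a′
      fits-agree (last p q) (last p′ q′) = agree refl refl refl λ x i≤x x≤i → at (≤-antisym i≤x x≤i)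
        where
        at : ∀ {x} → _ ≡ x → l x ≡ l′ x × u x ≡ u′ x
        at refl = trans p (sym p′) , trans q (sym q′)
      fits-agree (left p q d) (left p′ q′ d′) with fitsDrop-agree d d′
      ... | A@(agree refl refl refl _) = agree-left p p′ (trans q (sym q′)) A refl
      fits-agree (turn {x = x} {b = b} p q r c) (turn {b = b′} p′ q′ r′ c′)
        with refl ← +-cancelʳ-≡ x b b′ (trans r (sym r′)) =
        agree-left p p′ (trans q (sym q′)) (fits-agree c c′) refl
      fits-agree (high c) (high c′) = fits⁺-agree c c′

      fits⁺-agree : ∀ {φ β p n} {c : Code⁺ φ β p n} {i j j′ f t t′ a a′ y} →
        Fits⁺ l u c i j f t a y → Fits⁺ l′ u′ c i j′ f t′ a′ y → Agree l u l′ u′ i j j′ t t′ a a′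
      fits⁺-agree (up c) (up c′) = fits-agree c c′
      fits⁺-agree {i = i} {suc j} (right p q c) (right p′ q′ c′) with fits⁺-agree c c′
      ... | agree refl refl refl f = agree refl refl refl g
        where
        g : ∀ x → i ≤ x → x ≤ suc j → l x ≡ l′ x × u x ≡ u′ x
        g x i≤x x≤j with m≤n⇒m<n∨m≡n x≤j
        ... | inj₁ x<j  = f x i≤x (s≤s⁻¹ x<j)
        ... | inj₂ refl = trans p (sym p′) , trans q (sym q′)

      fitsDrop-agree : ∀ {β p n} {d : Drop β p n} {i j j′ f t t′ a a′ y} →
        FitsDrop l u d i j f t a y → FitsDrop l′ u′ d i j′ f t′ a′ y → Agree l u l′ u′ i j j′ t t′ a a′
      fitsDrop-agree (stay c) (stay c′) = fits-agree c c′
      fitsDrop-agree (down d) (down d′) with fitsDrop-agree d d′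
      ... | agree refl refl refl f = agree refl refl refl f

  fill-cong : ∀ {w h l u l′ u′} → (∀ x → x < w → l x ≡ l′ x × u x ≡ u′ x) → fill w h l u ≡ fill w h l′ u′
  fill-cong {w} {h} {l} {u} {l′} {u′} e = cong {A = Vec (Vec Bool h) w} (λ v → w , h , v) (tabulate-cong λ x → tabulate-cong λ y →
    let p , q = e (toℕ x) (toℕ<n x) in cong₂ (λ a b → within a b (toℕ y)) p q)

  mutual
    fits-depth : ∀ {l u φ β p n} {c : Code φ β p n} {i j f t a y} → Fits l u c i j f t a y → a ≡ f + depth c
    fits-depth (last _ _)         = sym (+-identityʳ _)
    fits-depth (left _ _ d)       = fitsDrop-depth d
    fits-depth (turn _ _ _ _)     = sym (+-identityʳ _)
    fits-depth (high c)           = fits⁺-depth c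

    fits⁺-depth : ∀ {l u φ β p n} {c : Code⁺ φ β p n} {i j f t a y} → Fits⁺ l u c i j f t a y → a ≡ f + depth⁺ c
    fits⁺-depth (up c)        = fits-depth c
    fits⁺-depth (right _ _ c) = fits⁺-depth c

    fitsDrop-depth : ∀ {l u β p n} {d : Drop β p n} {i j f t a y} → FitsDrop l u d i j f t a y → a ≡ f + depthDrop d
    fitsDrop-depth (stay c) = fits-depth c
    fitsDrop-depth (down d) = trans (cong suc (fitsDrop-depth d)) (sym (+-suc _ _))

  gridOf-fill : ∀ {n l u j t a} {c : Whole n} → Fits l u c 0 j 0 t a a → gridOf c ≡ fill (suc j) (suc t) l u
  gridOf-fill {c = c} fits with refl ← fits-depth fits with profileOf c
  ... | l′ , u′ , j′ , t′ , fits′ with fits-agree fits′ fits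
  ...   | agree refl refl _ e = fill-cong λ x x<w → e x z≤n (s≤s⁻¹ x<w)

  ascending⇒grid : ∀ {m g} → IsAscending m g → Σ ℕ λ n → Σ (Whole n) λ c → gridOf c ≡ g
  ascending⇒grid {m} {g} asc with analyse asc
  ... | P = coded (fitting j (hi 0 ∸ lo 0) falling level {p = 0} refl (m+[n∸m]≡n (A .nonempty 0 z≤n z≤n)) l₀≤ A (+-identityʳ _) _)
    where
    open Profile P renaming (ascending to A; columns to C)
    -- The last column must not end below the initial height; comparability of the two outer columns
    -- rules this out.
    l₀≤ : lo 0 ≤ hi j
    l₀≤ with m≤n⇒m<n∨m≡n (z≤n {j})
    ... | inj₂ refl = A .nonempty 0 z≤n z≤n
    ... | inj₁ 0<j with A .comparable 0 j z≤n 0<j ≤-refl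
    ...   | inj₁ q = ≤-trans (A .nonempty 0 z≤n z≤n) q
    ...   | inj₂ q = ≤-trans q (A .nonempty j z≤n ≤-refl)

    coded : Fitting {lo} {hi} falling level 0 0 j (lo 0) → Σ ℕ λ n → Σ (Whole n) λ c → gridOf c ≡ g
    coded (n , c , f , t , fits) = n , c , filled (n≤0⇒n≡0 floor≤0) fits (≤-antisym 1+t≤h h≤1+t)
      where
      S = whole-shape fits
      tight = proj₁ asc
      floor≤0 : f ≤ 0
      floor≤0 with proj₂ (proj₂ tight)
      ... | (x , p) , _ = ≤-trans (S .floor≤ x z≤n (proj₁ (C .column p))) (proj₁ (proj₂ (C .column p)))
      1+t≤h : suc t ≤ height g
      1+t≤h with S .top
      ... | x , _ , x≤j , e with C .cell x≤j (A .nonempty x z≤n x≤j) ≤-refl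
      ...   | _ , q , _ = ≤-trans (s≤s (≤-reflexive (sym e))) q
      h≤1+t : height g ≤ suc t
      h≤1+t with proj₂ (proj₂ (proj₂ tight))
      ... | x , p = ≤-trans (pred≤ (height g)) (s≤s (≤-trans (proj₂ (proj₂ (C .column p))) (S .≤top x z≤n (proj₁ (C .column p)))))
        where
        pred≤ : ∀ h → h ≤ suc (h ∸ 1)
        pred≤ zero    = z≤n
        pred≤ (suc h) = ≤-refl
      filled : ∀ {f} → f ≡ 0 → Fits lo hi c 0 j f t (lo 0) (lo 0) → suc t ≡ height g → gridOf c ≡ g
      filled refl fits h≡ = trans (gridOf-fill fits) (rebuild {g} width≡ h≡ C)
        where
        rebuild : ∀ {g} → width g ≡ suc j → suc t ≡ height g → Columns g lo hi j → fill (suc j) (suc t) lo hi ≡ g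
        rebuild {_ , _ , v} refl refl C′ = cong (λ v → suc j , suc t , v) (grid-ext
          (λ _ p → let x≤j , l≤ , ≤u = F .column p in C′ .cell x≤j l≤ ≤u)
          (λ _ p → let x≤j , l≤ , ≤u = C′ .column p in F .cell x≤j l≤ ≤u))
          where F = fill-columns {lo} {hi} (λ x → S .≤top x z≤n)

  -- The shift by one is the initial row, for which no step is paid.
  #ascending : ℕ → ℕ
  #ascending zero    = 0
  #ascending (suc n) = #Code falling level 0 n

  ascending-size : ∀ {m n} {c : Whole n} → IsAscending m (gridOf c) → m ≡ suc n
  ascending-size {c = c} (_ , _ , _ , _ , e) with gridOf-ascending c
  ... | _ , _ , _ , _ , e′ = trans (sym e) e′

  countsAscending : CountsAscending #ascending
  countsAscending zero = [] , [] , (λ g → mk⇔ (λ ()) (λ asc → contradiction asc none)) , refl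
    where
    none : ∀ {g} → ¬ IsAscending 0 g
    none asc with ascending⇒grid asc
    ... | n , c , refl = contradiction (ascending-size {c = c} asc) λ ()
  countsAscending (suc n) =
    map grid (allFin N′) , Unique.map⁺ grid-injective (Unique.allFin⁺ N′) ,
    (λ g → mk⇔ (member⇒ g) (⇒member g)) , trans (length-map grid (allFin N′)) (length-tabulate id)
    where
    N′ = #Code falling level 0 n
    iso = finCode falling level 0 n
    open Inverse iso using (to; from; strictlyInverseˡ; strictlyInverseʳ)
    grid : Fin N′ → Grid
    grid = gridOf ∘ to
    grid-injective : ∀ {i k} → grid i ≡ grid k → i ≡ k
    grid-injective {i} {k} e =
      trans (sym (strictlyInverseʳ i)) (trans (cong from (gridOf-injective e)) (strictlyInverseʳ k))
    member⇒ : ∀ g → g ∈ map grid (allFin N′) → IsAscending (suc n) g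
    member⇒ g p with ∈-map⁻ grid p
    ... | i , _ , refl = gridOf-ascending (to i)
    ⇒member : ∀ g → IsAscending (suc n) g → g ∈ map grid (allFin N′)
    ⇒member g asc with ascending⇒grid asc
    ... | m , c , refl with refl ← ascending-size {c = c} asc =
      subst (λ c′ → gridOf c′ ∈ map grid (allFin N′)) (strictlyInverseˡ c) (∈-map⁺ grid (∈-allFin (from c)))

-- Formal power series over ℚ as a commutative ring with integer constants.

module PowerSeries where

  open import Data.Nat using (zero; suc; _∸_; _≤_; z≤n)
  import Data.Nat.Properties as ℕₚ
  open import Data.Integer using (ℤ; +_)
  import Data.Integer as ℤ
  import Data.Integer.Properties as ℤₚ
  open import Data.Rational using (ℚ; 0ℚ; 1ℚ; toℚᵘ) renaming (_+_ to _+q_; _*_ to _*q_; -_ to -q_)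
  import Data.Rational.Properties as ℚₚ
  open import Data.Rational.Unnormalised using (mkℚᵘ; *≡*) renaming (_≃_ to _≃ᵘ_)
  import Data.Rational.Unnormalised.Properties as ℚᵘₚ
  open import Data.Product using (_,_)
  open import Relation.Binary.PropositionalEquality using (_≡_; refl; sym; trans; cong; cong₂; module ≡-Reasoning)
  open import Function using (_∘_)
  open import Algebra.Bundles using (CommutativeRing)
  open import Algebra.Solver.Ring.AlmostCommutativeRing

  neg : Series → Series
  neg f n = -q (f n)

  tail : Series → Series
  tail f n = f (suc n)

  sumTo-cong : ∀ n {f g} → (∀ k → k ≤ n → f k ≡ g k) → sumTo n f ≡ sumTo n g
  sumTo-cong zero    e = e 0 z≤n
  sumTo-cong (suc n) e = cong₂ _+q_ (sumTo-cong n (λ k k≤n → e k (ℕₚ.m≤n⇒m≤1+n k≤n))) (e (suc n) ℕₚ.≤-refl)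

  sumTo-front : ∀ n f → sumTo (suc n) f ≡ f 0 +q sumTo n (f ∘ suc)
  sumTo-front zero    f = refl
  sumTo-front (suc n) f = trans (cong (_+q f (suc (suc n))) (sumTo-front n f)) (ℚₚ.+-assoc (f 0) _ _)

  -- The ring laws of the Cauchy product follow from this recursion by induction on the coefficient,
  -- with `tail f` in place of `f`.
  ⊗-front : ∀ f g n → (f ⊗ g) (suc n) ≡ f 0 *q g (suc n) +q (tail f ⊗ g) n
  ⊗-front f g n = sumTo-front n _

  -- Supports commutativity: splitting off the front of one product corresponds to splitting off the
  -- back of the product in the other order.
  ⊗-back : ∀ f g n → (f ⊗ g) (suc n) ≡ (f ⊗ tail g) n +q f (suc n) *q g 0
  ⊗-back f g n = cong₂ _+q_
    (sumTo-cong n λ k k≤n → cong (λ m → f k *q g m) (ℕₚ.+-∸-assoc 1 k≤n))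
    (cong (λ m → f (suc n) *q g m) (ℕₚ.n∸n≡0 n))

  ⊗-cong : ∀ {f f′ g g′} → f ≈ₛ f′ → g ≈ₛ g′ → f ⊗ g ≈ₛ f′ ⊗ g′
  ⊗-cong p q n = sumTo-cong n λ k _ → cong₂ _*q_ (p k) (q (n ∸ k))

  ⊗-comm : ∀ f g → f ⊗ g ≈ₛ g ⊗ f
  ⊗-comm f g zero    = ℚₚ.*-comm (f 0) (g 0)
  ⊗-comm f g (suc n) = begin
    (f ⊗ g) (suc n)                      ≡⟨ ⊗-front f g n ⟩
    f 0 *q g (suc n) +q (tail f ⊗ g) n   ≡⟨ ℚₚ.+-comm (f 0 *q g (suc n)) _ ⟩
    (tail f ⊗ g) n +q f 0 *q g (suc n)   ≡⟨ cong₂ _+q_ (⊗-comm (tail f) g n) (ℚₚ.*-comm (f 0) _) ⟩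
    (g ⊗ tail f) n +q g (suc n) *q f 0   ≡⟨ ⊗-back g f n ⟨
    (g ⊗ f) (suc n)                      ∎
    where open ≡-Reasoning

  +-interchange : ∀ a b c d → (a +q b) +q (c +q d) ≡ (a +q c) +q (b +q d)
  +-interchange a b c d = begin
    (a +q b) +q (c +q d)   ≡⟨ ℚₚ.+-assoc a b _ ⟩
    a +q (b +q (c +q d))   ≡⟨ cong (a +q_) (trans (sym (ℚₚ.+-assoc b c d)) (trans (cong (_+q d) (ℚₚ.+-comm b c)) (ℚₚ.+-assoc c b d))) ⟩
    a +q (c +q (b +q d))   ≡⟨ ℚₚ.+-assoc a c _ ⟨
    (a +q c) +q (b +q d)   ∎
    where open ≡-Reasoning

  ⊗-distribʳ : ∀ f g h → (g ⊕ h) ⊗ f ≈ₛ (g ⊗ f) ⊕ (h ⊗ f)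
  ⊗-distribʳ f g h zero    = ℚₚ.*-distribʳ-+ (f 0) (g 0) (h 0)
  ⊗-distribʳ f g h (suc n) = begin
    ((g ⊕ h) ⊗ f) (suc n)
      ≡⟨ ⊗-front (g ⊕ h) f n ⟩
    (g 0 +q h 0) *q f (suc n) +q ((tail g ⊕ tail h) ⊗ f) n
      ≡⟨ cong₂ _+q_ (ℚₚ.*-distribʳ-+ (f (suc n)) (g 0) (h 0)) (⊗-distribʳ f (tail g) (tail h) n) ⟩
    (g 0 *q f (suc n) +q h 0 *q f (suc n)) +q ((tail g ⊗ f) n +q (tail h ⊗ f) n)
      ≡⟨ +-interchange (g 0 *q f (suc n)) _ _ _ ⟩
    (g 0 *q f (suc n) +q (tail g ⊗ f) n) +q (h 0 *q f (suc n) +q (tail h ⊗ f) n)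
      ≡⟨ cong₂ _+q_ (⊗-front g f n) (⊗-front h f n) ⟨
    (g ⊗ f) (suc n) +q (h ⊗ f) (suc n) ∎
    where open ≡-Reasoning

  scale : ℚ → Series → Series
  scale a f n = a *q f n

  scale-⊗ : ∀ a f g → scale a f ⊗ g ≈ₛ scale a (f ⊗ g)
  scale-⊗ a f g zero    = ℚₚ.*-assoc a (f 0) (g 0)
  scale-⊗ a f g (suc n) = begin
    (scale a f ⊗ g) (suc n)                              ≡⟨ ⊗-front (scale a f) g n ⟩
    (a *q f 0) *q g (suc n) +q (scale a (tail f) ⊗ g) n  ≡⟨ cong₂ _+q_ (ℚₚ.*-assoc a (f 0) _) (scale-⊗ a (tail f) g n) ⟩
    a *q (f 0 *q g (suc n)) +q a *q (tail f ⊗ g) n       ≡⟨ ℚₚ.*-distribˡ-+ a _ _ ⟨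
    a *q (f 0 *q g (suc n) +q (tail f ⊗ g) n)            ≡⟨ cong (a *q_) (⊗-front f g n) ⟨
    a *q (f ⊗ g) (suc n)                                 ∎
    where open ≡-Reasoning

  ⊗-assoc : ∀ f g h → (f ⊗ g) ⊗ h ≈ₛ f ⊗ (g ⊗ h)
  ⊗-assoc f g h zero    = ℚₚ.*-assoc (f 0) (g 0) (h 0)
  ⊗-assoc f g h (suc n) = begin
    ((f ⊗ g) ⊗ h) (suc n)
      ≡⟨ ⊗-front (f ⊗ g) h n ⟩
    (f 0 *q g 0) *q h (suc n) +q (tail (f ⊗ g) ⊗ h) n
      ≡⟨ cong ((f 0 *q g 0) *q h (suc n) +q_) (trans (⊗-cong {g = h} (⊗-front f g) (λ _ → refl) n)
           (trans (⊗-distribʳ h (scale (f 0) (tail g)) (tail f ⊗ g) n)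
             (cong₂ _+q_ (scale-⊗ (f 0) (tail g) h n) (⊗-assoc (tail f) g h n)))) ⟩
    (f 0 *q g 0) *q h (suc n) +q (f 0 *q (tail g ⊗ h) n +q (tail f ⊗ (g ⊗ h)) n)
      ≡⟨ ℚₚ.+-assoc ((f 0 *q g 0) *q h (suc n)) (f 0 *q (tail g ⊗ h) n) _ ⟨
    ((f 0 *q g 0) *q h (suc n) +q f 0 *q (tail g ⊗ h) n) +q (tail f ⊗ (g ⊗ h)) n
      ≡⟨ cong (_+q (tail f ⊗ (g ⊗ h)) n) (trans (cong (_+q f 0 *q (tail g ⊗ h) n) (ℚₚ.*-assoc (f 0) _ _))
           (trans (sym (ℚₚ.*-distribˡ-+ (f 0) _ _)) (cong (f 0 *q_) (sym (⊗-front g h n))))) ⟩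
    f 0 *q (g ⊗ h) (suc n) +q (tail f ⊗ (g ⊗ h)) n
      ≡⟨ ⊗-front f (g ⊗ h) n ⟨
    (f ⊗ (g ⊗ h)) (suc n) ∎
    where open ≡-Reasoning

  ⊗-zeroˡ : ∀ f → (∀ n → f n ≡ 0ℚ) → ∀ g n → (f ⊗ g) n ≡ 0ℚ
  ⊗-zeroˡ f z g zero    = trans (cong (_*q g 0) (z 0)) (ℚₚ.*-zeroˡ (g 0))
  ⊗-zeroˡ f z g (suc n) = trans (⊗-front f g n)
    (cong₂ _+q_ (trans (cong (_*q g (suc n)) (z 0)) (ℚₚ.*-zeroˡ (g (suc n)))) (⊗-zeroˡ (tail f) (z ∘ suc) g n))

  const-⊗ : ∀ a f → const a ⊗ f ≈ₛ scale a f
  const-⊗ a f zero    = refl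
  const-⊗ a f (suc n) = trans (⊗-front (const a) f n)
    (trans (cong (a *q f (suc n) +q_) (⊗-zeroˡ (tail (const a)) (λ _ → refl) f n)) (ℚₚ.+-identityʳ _))

  X-⊗-zero : ∀ f → (X ⊗ f) 0 ≡ 0ℚ
  X-⊗-zero f = ℚₚ.*-zeroˡ (f 0)

  tail-X : tail X ≈ₛ const 1ℚ
  tail-X zero    = refl
  tail-X (suc _) = refl

  X-⊗-suc : ∀ f n → (X ⊗ f) (suc n) ≡ f n
  X-⊗-suc f n = begin
    (X ⊗ f) (suc n)                    ≡⟨ ⊗-front X f n ⟩
    0ℚ *q f (suc n) +q (tail X ⊗ f) n  ≡⟨ cong₂ _+q_ (ℚₚ.*-zeroˡ (f (suc n))) (trans (⊗-cong {g = f} tail-X (λ _ → refl) n) (const-⊗ 1ℚ f n)) ⟩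
    0ℚ +q 1ℚ *q f n                    ≡⟨ trans (ℚₚ.+-identityˡ _) (ℚₚ.*-identityˡ (f n)) ⟩
    f n                                ∎
    where open ≡-Reasoning

  seriesRing : CommutativeRing _ _
  seriesRing = record
    { Carrier = Series ; _≈_ = _≈ₛ_ ; _+_ = _⊕_ ; _*_ = _⊗_ ; -_ = neg ; 0# = const 0ℚ ; 1# = const 1ℚ
    ; isCommutativeRing = record
      { isRing = record
        { +-isAbelianGroup = record
          { isGroup = record
            { isMonoid = record
              { isSemigroup = record
                { isMagma = record
                  { isEquivalence = record
                    { refl = λ _ → refl ; sym = λ p n → sym (p n) ; trans = λ p q n → trans (p n) (q n) }
                  ; ∙-cong = λ p q n → cong₂ _+q_ (p n) (q n) }
                ; assoc = λ f g h n → ℚₚ.+-assoc (f n) (g n) (h n) }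
              ; identity = (λ f n → trans (cong (_+q f n) (const-zero n)) (ℚₚ.+-identityˡ (f n)))
                         , (λ f n → trans (cong (f n +q_) (const-zero n)) (ℚₚ.+-identityʳ (f n))) }
            ; inverse = (λ f n → trans (ℚₚ.+-inverseˡ (f n)) (sym (const-zero n)))
                      , (λ f n → trans (ℚₚ.+-inverseʳ (f n)) (sym (const-zero n)))
            ; ⁻¹-cong = λ p n → cong -q_ (p n) }
          ; comm = λ f g n → ℚₚ.+-comm (f n) (g n) }
        ; *-cong = ⊗-cong
        ; *-assoc = ⊗-assoc
        ; *-identity = identityˡ , λ f n → trans (⊗-comm f (const 1ℚ) n) (identityˡ f n)
        ; distrib = (λ f g h n → trans (⊗-comm f (g ⊕ h) n)
                      (trans (⊗-distribʳ f g h n) (cong₂ _+q_ (⊗-comm g f n) (⊗-comm h f n))))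
                  , ⊗-distribʳ }
      ; *-comm = ⊗-comm } }
    where
    const-zero : ∀ n → const 0ℚ n ≡ 0ℚ
    const-zero zero    = refl
    const-zero (suc n) = refl
    identityˡ : ∀ f → const 1ℚ ⊗ f ≈ₛ f
    identityˡ f n = trans (const-⊗ 1ℚ f n) (ℚₚ.*-identityˡ (f n))

  -- `int i` is stuck on normalisation for a variable `i`, so the homomorphism laws are checked on
  -- unnormalised rationals with denominator 1.
  int-homo : ∀ i {p} → toℚᵘ p ≃ᵘ mkℚᵘ i 0 → int i ≡ p
  int-homo i {p} e = ℚₚ.toℚᵘ-injective (ℚᵘₚ.≃-trans (ℚₚ.toℚᵘ-fromℚᵘ (mkℚᵘ i 0)) (ℚᵘₚ.≃-sym e))

  toℚᵘ-int : ∀ i → toℚᵘ (int i) ≃ᵘ mkℚᵘ i 0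
  toℚᵘ-int i = ℚₚ.toℚᵘ-fromℚᵘ (mkℚᵘ i 0)

  int-+ : ∀ i j → int (i ℤ.+ j) ≡ int i +q int j
  int-+ i j = int-homo (i ℤ.+ j) (ℚᵘₚ.≃-trans (ℚₚ.toℚᵘ-homo-+ (int i) (int j))
    (ℚᵘₚ.≃-trans (ℚᵘₚ.+-cong (toℚᵘ-int i) (toℚᵘ-int j))
      (*≡* (cong₂ ℤ._*_ (cong₂ ℤ._+_ (ℤₚ.*-identityʳ i) (ℤₚ.*-identityʳ j)) refl))))

  int-* : ∀ i j → int (i ℤ.* j) ≡ int i *q int j
  int-* i j = int-homo (i ℤ.* j) (ℚᵘₚ.≃-trans (ℚₚ.toℚᵘ-homo-* (int i) (int j))
    (ℚᵘₚ.*-cong (toℚᵘ-int i) (toℚᵘ-int j)))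

  int-neg : ∀ i → int (ℤ.- i) ≡ -q int i
  int-neg i = int-homo (ℤ.- i) (ℚᵘₚ.≃-trans (ℚₚ.toℚᵘ-homo‿- (int i)) (ℚᵘₚ.-‿cong (toℚᵘ-int i)))

  seriesACR : AlmostCommutativeRing _ _
  seriesACR = fromCommutativeRing seriesRing

  ℤ→Series : CommutativeRing.rawRing ℤₚ.+-*-commutativeRing -Raw-AlmostCommutative⟶ seriesACR
  ℤ→Series = record
    { ⟦_⟧    = cst
    ; +-homo = λ i j → λ { zero → int-+ i j ; (suc n) → refl }
    ; *-homo = λ i j → λ { zero    → trans (int-* i j) (sym (const-⊗ (int i) (cst j) 0))
                         ; (suc n) → sym (trans (const-⊗ (int i) (cst j) (suc n)) (ℚₚ.*-zeroʳ (int i))) }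
    ; -‿homo = λ i → λ { zero → int-neg i ; (suc n) → refl }
    ; 0-homo = λ _ → refl
    ; 1-homo = λ _ → refl
    }

-- The linear system over a commutative ring and the verification of its closed form.

module Elimination where

  open import Data.Nat using (ℕ; zero; suc)
  open import Data.Integer using (ℤ; +_)
  import Data.Integer as ℤ
  import Data.Integer.Properties as ℤₚ
  open import Data.List using (List; []; _∷_)
  open import Data.Maybe using (Maybe; just; nothing)
  open import Data.Product using (_,_)
  open import Relation.Nullary using (yes; no)
  open import Relation.Binary.PropositionalEquality as ≡ using (_≡_)
  open import Algebra.Bundles using (CommutativeRing; RawRing)
  open import Algebra.Solver.Ring.AlmostCommutativeRing
  import Algebra.Solver.Ring as RingSolver
  open import Level using (0ℓ)

  ⊝_ : ℕ → ℤ
  ⊝ n = ℤ.- (+ n)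
  infix 8 ⊝_

  -- Parametrised by a raw ring so that each formula is written once and read both in the ring
  -- itself and as syntax for the ring solver.
  module Forms (S : RawRing 0ℓ 0ℓ) (♯ : ℤ → RawRing.Carrier S) where
    open RawRing S using (Carrier; _+_; _*_; -_)

    infixl 6 _-_
    _-_ : Carrier → Carrier → Carrier
    x - y = x + (- y)

    poly : List ℤ → Carrier → Carrier
    poly []       t = ♯ (+ 0)
    poly (c ∷ cs) t = ♯ c + t * poly cs t

    cube fourth : Carrier → Carrier
    cube x = x * (x * x)
    fourth x = x * (x * (x * x))

    -- `disc t` is the discriminant 1 - 4t of z - z² - t, and `den t` is (1 - 2t)(1 - 4t).
    disc den : Carrier → Carrier
    disc t = poly (+ 1 ∷ ⊝ 4 ∷ []) t
    den t = poly (+ 1 ∷ ⊝ 6 ∷ + 8 ∷ []) t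

    module _ (t : Carrier) where
      -- Differences of the defining equations at p and p + 1 (primed), in which the partial sums
      -- cancel.
      u-relation v-relation : (u v u′ v′ : Carrier) → Carrier
      u-relation u v u′ v′ = u′ - t * u′ - v′ - u + v
      v-relation u v u′ v′ = v′ - t * v′ - t * u′ - v + t * u

      u₀-relation v₀-relation : (u₀ v₀ : Carrier) → Carrier
      u₀-relation u₀ v₀ = u₀ - t - t * u₀ - v₀
      v₀-relation u₀ v₀ = v₀ - t * u₀ - t * v₀

      C-relation : Carrier → Carrier
      C-relation C = C - ♯ (+ 1) - t * (C * C)

      root : Carrier → Carrier
      root C = ♯ (+ 1) - ♯ (+ 2) * (t * C)

      -- The solution of the system below, cleared of denominators; γ stands for C ^ p.  It was
      -- found by the kernel method, the kernel being z ↦ (1 - 2t) (z - z² - t) with root t C.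
      Û ĝ ê b̂ Ê B̂ : (C γ u v : Carrier) → Carrier
      Û C γ u v = poly (+ 1 ∷ ⊝ 4 ∷ + 2 ∷ []) t * u + t * v - ♯ (+ 2) * (cube t * (C * C * γ))
      ĝ C γ u v = cube t * u + poly (+ 1 ∷ ⊝ 6 ∷ + 9 ∷ ⊝ 2 ∷ []) t * v - fourth t * (C * C * γ)
      ê C γ u v = poly (+ 1 ∷ ⊝ 6 ∷ + 9 ∷ ⊝ 2 ∷ []) t * u + t * t * v - fourth t * (cube C * γ)
      b̂ C γ u v = poly (+ 1 ∷ ⊝ 5 ∷ + 5 ∷ []) t * u + ♯ (+ 2) * (t * t) * v - fourth t * (fourth C * γ)
      Ê C γ u v = poly (+ 1 ∷ ⊝ 10 ∷ + 35 ∷ ⊝ 50 ∷ + 27 ∷ ⊝ 4 ∷ []) t * u + t * poly (+ 1 ∷ ⊝ 5 ∷ + 5 ∷ []) t * v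
        - root C * (cube t * ((poly (+ 2 ∷ ⊝ 4 ∷ []) t + t * C) * γ))
      B̂ C γ u v = poly (+ 1 ∷ ⊝ 9 ∷ + 27 ∷ ⊝ 30 ∷ + 12 ∷ []) t * u + t * poly (+ 1 ∷ ⊝ 3 ∷ ⊝ 3 ∷ + 4 ∷ []) t * v
        - root C * (cube t * ((poly (+ 2 ∷ ⊝ 4 ∷ []) t + t * C) * (C * γ)))

      δU δg δe δb δE δB : (x C γ u v : Carrier) → Carrier
      δU x C γ u v = disc t * x - Û C γ u v
      δg x C γ u v = den t * x - ĝ C γ u v
      δe x C γ u v = den t * x - ê C γ u v
      δb x C γ u v = den t * x - b̂ C γ u v
      δE x C γ u v = den t * disc t * x - Ê C γ u v
      δB x C γ u v = den t * disc t * x - B̂ C γ u v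

  module Kernel (R : AlmostCommutativeRing 0ℓ 0ℓ)
    (hom : CommutativeRing.rawRing ℤₚ.+-*-commutativeRing -Raw-AlmostCommutative⟶ R) where

    open AlmostCommutativeRing R
    open _-Raw-AlmostCommutative⟶_ hom using (⟦_⟧; 0-homo)
    open import Relation.Binary.Reasoning.Setoid setoid

    private
      coeff≟ : ∀ i j → Maybe (⟦ i ⟧ ≈ ⟦ j ⟧)
      coeff≟ i j with i ℤ.≟ j
      ... | yes ≡.refl = just refl
      ... | no _       = nothing

    open RingSolver _ R hom coeff≟ using (Polynomial; con; _:+_; _:*_; :-_; _:-_; _:^_; solve; _:=_)

    polynomials : ℕ → RawRing 0ℓ 0ℓ
    polynomials n = record
      { Carrier = Polynomial n ; _≈_ = _≡_ ; _+_ = _:+_ ; _*_ = _:*_ ; -_ = :-_ ; 0# = con (+ 0) ; 1# = con (+ 1) }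

    module P {n : ℕ} = Forms (polynomials n) con

    open Forms rawRing ⟦_⟧ public

    𝟎 : Carrier
    𝟎 = ⟦ + 0 ⟧

    -- Goals are reduced to ring identities by exhibiting the multipliers α of the relations r.
    elim : ∀ {x y α r} → r ≈ 𝟎 → x ≈ y + α * r → x ≈ y
    elim {x} {y} {α} {r} r≈0 e = begin
      x            ≈⟨ e ⟩
      y + α * r    ≈⟨ +-congˡ (*-congˡ (trans r≈0 0-homo)) ⟩
      y + α * 0#   ≈⟨ trans (+-congˡ (zeroʳ α)) (+-identityʳ y) ⟩
      y            ∎

    ∑ : ℕ → (ℕ → Carrier) → Carrier
    ∑ zero    f = 𝟎
    ∑ (suc p) f = f p + ∑ p f

    difference : ∀ {x y} → x ≈ y → x - y ≈ 𝟎
    difference {x} {y} e = trans (+-congʳ e) (solve 1 (λ y → y :- y := con (+ 0)) refl y)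

    module _ {t C : Carrier} (rC : C-relation t C ≈ 𝟎) where

      -- The candidates satisfy the recurrence of the unknowns modulo the relations for u, v and C.
      -- Multiplying that recurrence by the common denominator and subtracting leaves a homogeneous
      -- recurrence for the residuals; the other steps work alike.
      δe-step : ∀ {u v γ e b g} → e - t * b - g - (u - t * u - v) ≈ 𝟎 →
        δe t e C γ u v ≈ t * δb t b C γ u v + δg t g C γ u v
      δe-step {u} {v} {γ} {e} {b} {g} r = elim r (elim rC
        (solve 8 (λ t C u v γ e b g →
          P.δe t e C γ u v :=
          t :* P.δb t b C γ u v :+ P.δg t g C γ u v :+ P.den t :* (e :- t :* b :- g :- (u :- t :* u :- v))
            :+ P.fourth t :* (C :* C :* γ) :* P.C-relation t C)
          refl t C u v γ e b g))

      δb-step : ∀ {u v u′ v′ γ e b b′} → u-relation t u v u′ v′ ≈ 𝟎 → v-relation t u v u′ v′ ≈ 𝟎 → b - e - t * b′ ≈ 𝟎 →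
        δb t b C γ u v ≈ δe t e C γ u v + t * δb t b′ C (C * γ) u′ v′
      δb-step {u} {v} {u′} {v′} {γ} {e} {b} {b′} ru rv r = elim r (elim ru (elim rv (elim rC
        (solve 10 (λ t C u v u′ v′ γ e b b′ →
          P.δb t b C γ u v :=
          P.δe t e C γ u v :+ t :* P.δb t b′ C (C :* γ) u′ v′ :+ P.den t :* (b :- e :- t :* b′)
            :+ P.poly (+ 0 ∷ + 1 ∷ ⊝ 3 ∷ []) t :* P.u-relation t u v u′ v′
            :+ P.poly (+ 0 ∷ + 1 ∷ ⊝ 2 ∷ []) t :* P.v-relation t u v u′ v′
            :+ P.fourth t :* (P.cube C :* γ) :* P.C-relation t C)
          refl t C u v u′ v′ γ e b b′))))

      δg-step : ∀ {u v u′ v′ γ e e′ g g′} → u-relation t u v u′ v′ ≈ 𝟎 → v-relation t u v u′ v′ ≈ 𝟎 →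
        g′ - g - t * (e′ - e + g′) ≈ 𝟎 →
        δg t g′ C (C * γ) u′ v′ ≈ δg t g C γ u v + t * (δe t e′ C (C * γ) u′ v′ - δe t e C γ u v + δg t g′ C (C * γ) u′ v′)
      δg-step {u} {v} {u′} {v′} {γ} {e} {e′} {g} {g′} ru rv r = elim r (elim ru (elim rv (elim rC
        (solve 11 (λ t C u v u′ v′ γ e e′ g g′ →
          P.δg t g′ C (C :* γ) u′ v′ :=
          P.δg t g C γ u v :+ t :* (P.δe t e′ C (C :* γ) u′ v′ :- P.δe t e C γ u v :+ P.δg t g′ C (C :* γ) u′ v′)
            :+ P.den t :* (g′ :- g :- t :* (e′ :- e :+ g′))
            :+ (:- P.cube t) :* P.u-relation t u v u′ v′
            :+ (:- P.poly (+ 1 ∷ ⊝ 6 ∷ + 9 ∷ ⊝ 2 ∷ []) t) :* P.v-relation t u v u′ v′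
            :+ P.fourth t :* (C :* C :* γ) :* P.C-relation t C)
          refl t C u v u′ v′ γ e e′ g g′))))

      δg-base : ∀ {u v e g} → u₀-relation t u v ≈ 𝟎 → v₀-relation t u v ≈ 𝟎 → g - t * (e + g) ≈ 𝟎 →
        δg t g C ⟦ + 1 ⟧ u v ≈ t * (δe t e C ⟦ + 1 ⟧ u v + δg t g C ⟦ + 1 ⟧ u v)
      δg-base {u} {v} {e} {g} r₀ r₁ r = elim r (elim r₀ (elim r₁ (elim rC
        (solve 6 (λ t C u v e g →
          P.δg t g C (con (+ 1)) u v :=
          t :* (P.δe t e C (con (+ 1)) u v :+ P.δg t g C (con (+ 1)) u v) :+ P.den t :* (g :- t :* (e :+ g))
            :+ (:- P.cube t) :* P.u₀-relation t u v
            :+ (:- P.poly (+ 1 ∷ ⊝ 6 ∷ + 9 ∷ ⊝ 2 ∷ []) t) :* P.v₀-relation t u v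
            :+ P.fourth t :* (C :+ con (+ 1)) :* P.C-relation t C)
          refl t C u v e g))))

      -- The recurrence for U is of second order in p, so the relations at two consecutive values of
      -- p are combined.
      δU-step : ∀ {u v u′ v′ u″ v″ γ x x′ x″} →
        u-relation t u v u′ v′ ≈ 𝟎 → v-relation t u v u′ v′ ≈ 𝟎 →
        u-relation t u′ v′ u″ v″ ≈ 𝟎 → v-relation t u′ v′ u″ v″ ≈ 𝟎 → x′ - x - t * x″ - t * v′ ≈ 𝟎 →
        δU t x′ C (C * γ) u′ v′ ≈ δU t x C γ u v + t * δU t x″ C (C * (C * γ)) u″ v″
      δU-step {u} {v} {u′} {v′} {u″} {v″} {γ} {x} {x′} {x″} ru rv ru′ rv′ r =
        elim r (elim ru (elim rv (elim ru′ (elim rv′ (elim rC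
        (solve 12 (λ t C u v u′ v′ u″ v″ γ x x′ x″ →
          P.δU t x′ C (C :* γ) u′ v′ :=
          P.δU t x C γ u v :+ t :* P.δU t x″ C (C :* (C :* γ)) u″ v″ :+ P.disc t :* (x′ :- x :- t :* x″ :- t :* v′)
            :+ P.poly (⊝ 1 ∷ + 3 ∷ []) t :* P.u-relation t u v u′ v′
            :+ P.poly (⊝ 1 ∷ + 2 ∷ []) t :* P.v-relation t u v u′ v′
            :+ P.poly (+ 0 ∷ + 1 ∷ ⊝ 2 ∷ []) t :* P.u-relation t u′ v′ u″ v″
            :+ t :* P.v-relation t u′ v′ u″ v″
            :+ con (+ 2) :* (P.cube t :* (C :* C :* γ)) :* P.C-relation t C)
          refl t C u v u′ v′ u″ v″ γ x x′ x″))))))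

      δU-base : ∀ {u v u′ v′ x x′} → u₀-relation t u v ≈ 𝟎 → v₀-relation t u v ≈ 𝟎 →
        u-relation t u v u′ v′ ≈ 𝟎 → v-relation t u v u′ v′ ≈ 𝟎 → x - t - t * x - t * x′ - v + t * u ≈ 𝟎 →
        δU t x C ⟦ + 1 ⟧ u v ≈ t * (δU t x C ⟦ + 1 ⟧ u v + δU t x′ C (C * ⟦ + 1 ⟧) u′ v′)
      δU-base {u} {v} {u′} {v′} {x} {x′} r₀ r₁ ru rv r = elim r (elim r₀ (elim r₁ (elim ru (elim rv (elim rC
        (solve 8 (λ t C u v u′ v′ x x′ →
          P.δU t x C (con (+ 1)) u v :=
          t :* (P.δU t x C (con (+ 1)) u v :+ P.δU t x′ C (C :* con (+ 1)) u′ v′)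
            :+ P.disc t :* (x :- t :- t :* x :- t :* x′ :- v :+ t :* u)
            :+ P.poly (⊝ 1 ∷ + 4 ∷ ⊝ 2 ∷ []) t :* P.u₀-relation t u v
            :+ (:- t) :* P.v₀-relation t u v
            :+ P.poly (+ 0 ∷ + 1 ∷ ⊝ 2 ∷ []) t :* P.u-relation t u v u′ v′
            :+ t :* P.v-relation t u v u′ v′
            :+ con (+ 2) :* (P.cube t :* (C :+ con (+ 1))) :* P.C-relation t C)
          refl t C u v u′ v′ x x′))))))

      δB-step : ∀ {u v u′ v′ γ e b b′} → u-relation t u v u′ v′ ≈ 𝟎 → v-relation t u v u′ v′ ≈ 𝟎 → b - e - t * b′ ≈ 𝟎 →
        δB t b C γ u v ≈ δE t e C γ u v + t * δB t b′ C (C * γ) u′ v′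
      δB-step {u} {v} {u′} {v′} {γ} {e} {b} {b′} ru rv r = elim r (elim ru (elim rv (elim rC
        (solve 10 (λ t C u v u′ v′ γ e b b′ →
          P.δB t b C γ u v :=
          P.δE t e C γ u v :+ t :* P.δB t b′ C (C :* γ) u′ v′ :+ P.den t :* P.disc t :* (b :- e :- t :* b′)
            :+ P.poly (+ 0 ∷ + 1 ∷ ⊝ 7 ∷ + 15 ∷ ⊝ 8 ∷ []) t :* P.u-relation t u v u′ v′
            :+ P.poly (+ 0 ∷ + 1 ∷ ⊝ 5 ∷ + 7 ∷ ⊝ 4 ∷ []) t :* P.v-relation t u v u′ v′
            :+ P.root t C :* (P.cube t :* ((P.poly (+ 2 ∷ ⊝ 4 ∷ []) t :+ t :* C) :* γ)) :* P.C-relation t C)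
          refl t C u v u′ v′ γ e b b′))))

      -- The inhomogeneous part for E consists of U, g, e, u and v. Replacing U, g and e by their
      -- candidates costs multiples of their residuals, which therefore have to vanish beforehand.
      δE-step : ∀ {u v u′ v′ γ e g x x′ E E′ B} →
        u-relation t u v u′ v′ ≈ 𝟎 → v-relation t u v u′ v′ ≈ 𝟎 →
        δU t x C γ u v ≈ 𝟎 → δU t x′ C (C * γ) u′ v′ ≈ 𝟎 → δg t g C γ u v ≈ 𝟎 → δe t e C γ u v ≈ 𝟎 →
        E - t * B - t * E′ - (x - t * x - t * x′ - v + t * u + g - t * e) ≈ 𝟎 →
        δE t E C γ u v ≈ t * δB t B C γ u v + t * δE t E′ C (C * γ) u′ v′
      δE-step {u} {v} {u′} {v′} {γ} {e} {g} {x} {x′} {E} {E′} {B} ru rv dU dU′ dg de r =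
        elim r (elim ru (elim rv (elim rC (elim dU (elim dU′ (elim dg (elim de
        (solve 14 (λ t C u v u′ v′ γ e g x x′ E E′ B →
          P.δE t E C γ u v :=
          t :* P.δB t B C γ u v :+ t :* P.δE t E′ C (C :* γ) u′ v′
            :+ P.den t :* P.disc t :* (E :- t :* B :- t :* E′ :- (x :- t :* x :- t :* x′ :- v :+ t :* u :+ g :- t :* e))
            :+ P.poly (+ 0 ∷ + 0 ∷ + 0 ∷ + 1 ∷ ⊝ 3 ∷ + 4 ∷ []) t :* P.u-relation t u v u′ v′
            :+ P.poly (+ 0 ∷ + 0 ∷ + 0 ∷ + 2 ∷ ⊝ 4 ∷ []) t :* P.v-relation t u v u′ v′
            :+ (:- (P.cube t :* γ)) :* (con (+ 4) :* (t :* (P.poly (+ 2 ∷ ⊝ 4 ∷ []) t :+ t :* C))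
                  :+ con (+ 2) :* (P.den t :* (C :+ con (+ 1))) :+ P.disc t :* (t :* C)) :* P.C-relation t C
            :+ P.den t :* P.poly (+ 1 ∷ ⊝ 1 ∷ []) t :* P.δU t x C γ u v
            :+ (:- (t :* P.den t)) :* P.δU t x′ C (C :* γ) u′ v′
            :+ P.disc t :* P.δg t g C γ u v
            :+ (:- (t :* P.disc t)) :* P.δe t e C γ u v)
          refl t C u v u′ v′ γ e g x x′ E E′ B))))))))

    -- u, v, e, g, b (U, V, E, G, B) count, with bound `fixed` (`level`), the rising codes, the
    -- rising codes⁺, the falling codes, the falling codes⁺ and the drops.
    record System (t : Carrier) (u v e g b U V E G B : ℕ → Carrier) : Set where
      field
        u-sum : ∀ p → u p ≈ t * (⟦ + 1 ⟧ + ∑ (suc p) u) + v p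
        v-sum : ∀ p → v p ≈ t * (u p + ∑ (suc p) v)
        e-sum : ∀ p → e p ≈ t * (⟦ + 1 ⟧ + (b p + ∑ p u)) + g p
        g-sum : ∀ p → g p ≈ t * (e p + ∑ (suc p) g)
        b-sum : ∀ p → b p ≈ e p + t * b (suc p)
        U-sum : ∀ p → U p ≈ t * (⟦ + 1 ⟧ + ∑ (suc p) U) + V p
        V-sum : ∀ p → V p ≈ t * (U (suc p) + ∑ (suc p) v)
        E-sum : ∀ p → E p ≈ t * (⟦ + 1 ⟧ + (B p + ∑ p U)) + G p
        G-sum : ∀ p → G p ≈ t * (E (suc p) + ∑ (suc p) g)
        B-sum : ∀ p → B p ≈ E p + t * B (suc p)

      u-rel : ∀ p → u-relation t (u p) (v p) (u (suc p)) (v (suc p)) ≈ 𝟎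
      u-rel p = elim (difference (u-sum p)) (elim (difference (u-sum (suc p)))
        (solve 6 (λ t u v u′ v′ σ → P.u-relation t u v u′ v′ :=
          con (+ 0) :+ (:- con (+ 1)) :* (u :- (t :* (con (+ 1) :+ σ) :+ v))
            :+ con (+ 1) :* (u′ :- (t :* (con (+ 1) :+ (u′ :+ σ)) :+ v′)))
          refl t (u p) (v p) (u (suc p)) (v (suc p)) (∑ (suc p) u)))

      v-rel : ∀ p → v-relation t (u p) (v p) (u (suc p)) (v (suc p)) ≈ 𝟎
      v-rel p = elim (difference (v-sum p)) (elim (difference (v-sum (suc p)))
        (solve 6 (λ t u v u′ v′ σ → P.v-relation t u v u′ v′ :=
          con (+ 0) :+ (:- con (+ 1)) :* (v :- t :* (u :+ σ)) :+ con (+ 1) :* (v′ :- t :* (u′ :+ (v′ :+ σ))))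
          refl t (u p) (v p) (u (suc p)) (v (suc p)) (∑ (suc p) v)))

      u₀-rel : u₀-relation t (u 0) (v 0) ≈ 𝟎
      u₀-rel = elim (difference (u-sum 0))
        (solve 3 (λ t u v → P.u₀-relation t u v :=
          con (+ 0) :+ con (+ 1) :* (u :- (t :* (con (+ 1) :+ (u :+ con (+ 0))) :+ v))) refl t (u 0) (v 0))

      v₀-rel : v₀-relation t (u 0) (v 0) ≈ 𝟎
      v₀-rel = elim (difference (v-sum 0))
        (solve 3 (λ t u v → P.v₀-relation t u v :=
          con (+ 0) :+ con (+ 1) :* (v :- t :* (u :+ (v :+ con (+ 0))))) refl t (u 0) (v 0))

      e-rel : ∀ p → e p - t * b p - g p - (u p - t * u p - v p) ≈ 𝟎
      e-rel p = elim (difference (e-sum p)) (elim (difference (u-sum p))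
        (solve 7 (λ t u v e b g σ → e :- t :* b :- g :- (u :- t :* u :- v) :=
          con (+ 0) :+ con (+ 1) :* (e :- (t :* (con (+ 1) :+ (b :+ σ)) :+ g))
            :+ (:- con (+ 1)) :* (u :- (t :* (con (+ 1) :+ (u :+ σ)) :+ v)))
          refl t (u p) (v p) (e p) (b p) (g p) (∑ p u)))

      g-rel : ∀ p → g (suc p) - g p - t * (e (suc p) - e p + g (suc p)) ≈ 𝟎
      g-rel p = elim (difference (g-sum p)) (elim (difference (g-sum (suc p)))
        (solve 6 (λ t e g e′ g′ σ → g′ :- g :- t :* (e′ :- e :+ g′) :=
          con (+ 0) :+ (:- con (+ 1)) :* (g :- t :* (e :+ σ)) :+ con (+ 1) :* (g′ :- t :* (e′ :+ (g′ :+ σ))))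
          refl t (e p) (g p) (e (suc p)) (g (suc p)) (∑ (suc p) g)))

      g₀-rel : g 0 - t * (e 0 + g 0) ≈ 𝟎
      g₀-rel = elim (difference (g-sum 0))
        (solve 3 (λ t e g → g :- t :* (e :+ g) := con (+ 0) :+ con (+ 1) :* (g :- t :* (e :+ (g :+ con (+ 0)))))
          refl t (e 0) (g 0))

      b-rel : ∀ p → b p - e p - t * b (suc p) ≈ 𝟎
      b-rel p = elim (difference (b-sum p))
        (solve 4 (λ t e b b′ → b :- e :- t :* b′ := con (+ 0) :+ con (+ 1) :* (b :- (e :+ t :* b′)))
          refl t (e p) (b p) (b (suc p)))

      B-rel : ∀ p → B p - E p - t * B (suc p) ≈ 𝟎
      B-rel p = elim (difference (B-sum p))
        (solve 4 (λ t e b b′ → b :- e :- t :* b′ := con (+ 0) :+ con (+ 1) :* (b :- (e :+ t :* b′)))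
          refl t (E p) (B p) (B (suc p)))

      -- V drops out between the differences of `U-sum` and of `V-sum`; this raises the order in p
      -- to two.
      U-rel : ∀ p → U (suc p) - U p - t * U (suc (suc p)) - t * v (suc p) ≈ 𝟎
      U-rel p = elim (difference (U-sum p)) (elim (difference (U-sum (suc p)))
        (elim (difference (V-sum p)) (elim (difference (V-sum (suc p)))
        (solve 9 (λ t x x′ x″ y y′ v′ σ τ → x′ :- x :- t :* x″ :- t :* v′ :=
          con (+ 0) :+ (:- con (+ 1)) :* (x :- (t :* (con (+ 1) :+ σ) :+ y))
            :+ con (+ 1) :* (x′ :- (t :* (con (+ 1) :+ (x′ :+ σ)) :+ y′))
            :+ (:- con (+ 1)) :* (y :- t :* (x′ :+ τ))
            :+ con (+ 1) :* (y′ :- t :* (x″ :+ (v′ :+ τ))))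
          refl t (U p) (U (suc p)) (U (suc (suc p))) (V p) (V (suc p)) (v (suc p)) (∑ (suc p) U) (∑ (suc p) v)))))

      U₀-rel : U 0 - t - t * U 0 - t * U 1 - v 0 + t * u 0 ≈ 𝟎
      U₀-rel = elim (difference (U-sum 0)) (elim (difference (V-sum 0)) (elim (difference (v-sum 0))
        (solve 6 (λ t x x′ y u v → x :- t :- t :* x :- t :* x′ :- v :+ t :* u :=
          con (+ 0) :+ con (+ 1) :* (x :- (t :* (con (+ 1) :+ (x :+ con (+ 0))) :+ y))
            :+ con (+ 1) :* (y :- t :* (x′ :+ (v :+ con (+ 0))))
            :+ (:- con (+ 1)) :* (v :- t :* (u :+ (v :+ con (+ 0)))))
          refl t (U 0) (U 1) (V 0) (u 0) (v 0))))

      -- The sums of g and of v occur under both bounds, so subtracting the equations for `fixed`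
      -- from those for `level` removes them; the sum of U is removed by `U-sum`.
      E-rel : ∀ p → E p - t * B p - t * E (suc p)
        - (U p - t * U p - t * U (suc p) - v p + t * u p + g p - t * e p) ≈ 𝟎
      E-rel p = elim (difference (E-sum p)) (elim (difference (G-sum p)) (elim (difference (g-sum p))
        (elim (difference (U-sum p)) (elim (difference (V-sum p)) (elim (difference (v-sum p))
        (solve 15 (λ t E E′ B G e g x x′ y u v ρ σ τ →
          E :- t :* B :- t :* E′ :- (x :- t :* x :- t :* x′ :- v :+ t :* u :+ g :- t :* e) :=
          con (+ 0) :+ con (+ 1) :* (E :- (t :* (con (+ 1) :+ (B :+ ρ)) :+ G))
            :+ con (+ 1) :* (G :- t :* (E′ :+ σ))
            :+ (:- con (+ 1)) :* (g :- t :* (e :+ σ))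
            :+ (:- con (+ 1)) :* (x :- (t :* (con (+ 1) :+ (x :+ ρ)) :+ y))
            :+ (:- con (+ 1)) :* (y :- t :* (x′ :+ τ))
            :+ con (+ 1) :* (v :- t :* (u :+ τ)))
          refl t (E p) (E (suc p)) (B p) (G p) (e p) (g p) (U p) (U (suc p)) (V p) (u p) (v p)
            (∑ p U) (∑ (suc p) g) (∑ (suc p) v)))))))

    open import Algebra.Properties.Semiring.Exp semiring using (_^_)

    -- `R` stands for (1 - 4t)^(-3/2), so R (1 - 4t)² is the square root of 1 - 4t.
    root-square : ∀ t R → R * R * (⟦ + 1 ⟧ - ⟦ + 4 ⟧ * t) ^ 3 ≈ ⟦ + 1 ⟧ →
      R * (⟦ + 1 ⟧ - ⟦ + 4 ⟧ * t) ^ 2 * (R * (⟦ + 1 ⟧ - ⟦ + 4 ⟧ * t) ^ 2) - disc t ≈ 𝟎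
    root-square t R hR = elim (difference hR)
      (solve 2 (λ t R → let s = con (+ 1) :- con (+ 4) :* t in
        R :* s :^ 2 :* (R :* s :^ 2) :- P.disc t := con (+ 0) :+ s :* (R :* R :* s :^ 3 :- con (+ 1))) refl t R)

    module _ (t h q C : Carrier) (half : ⟦ + 2 ⟧ * h ≈ ⟦ + 1 ⟧) (tC : t * C ≈ h * (⟦ + 1 ⟧ - q)) where

      root≈ : root t C ≈ q
      root≈ = elim (difference tC) (elim (difference half)
        (solve 4 (λ t h q C → P.root t C :=
          q :+ (:- con (+ 2)) :* (t :* C :- h :* (con (+ 1) :- q)) :+ (q :- con (+ 1)) :* (con (+ 2) :* h :- con (+ 1)))
          refl t h q C))

      -- `C` is known only through t C = (1 - q) / 2, hence the factor t, which is cancelled later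
      -- among power series.
      t*C-relation : q * q - disc t ≈ 𝟎 → t * C-relation t C ≈ 𝟎
      t*C-relation qq = elim (difference tC) (elim (difference half) (elim qq
        (solve 4 (λ t h q C → t :* P.C-relation t C :=
          con (+ 0) :+ (con (+ 1) :- t :* C :- h :* (con (+ 1) :- q)) :* (t :* C :- h :* (con (+ 1) :- q))
            :+ (t :* (con (+ 2) :* h :+ con (+ 1)) :- h :* (con (+ 1) :- q)) :* (con (+ 2) :* h :- con (+ 1))
            :+ (:- (h :* h)) :* (q :* q :- P.disc t))
          refl t h q C)))

    solved-form : ∀ {t C u v E Q₁ Q₂ R} → C-relation t C ≈ 𝟎 → u₀-relation t u v ≈ 𝟎 → v₀-relation t u v ≈ 𝟎 →
      δE t E C ⟦ + 1 ⟧ u v ≈ 𝟎 →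
      Q₁ * (⟦ + 2 ⟧ * (⟦ + 1 ⟧ - ⟦ + 4 ⟧ * t) ^ 2) ≈ ⟦ + 1 ⟧ →
      Q₂ * (⟦ + 2 ⟧ * (⟦ + 1 ⟧ - ⟦ + 2 ⟧ * t)) ≈ ⟦ + 1 ⟧ →
      root t C ≈ R * (⟦ + 1 ⟧ - ⟦ + 4 ⟧ * t) ^ 2 →
      t * E ≈ t ^ 2 * (⟦ + 2 ⟧ - ⟦ + 12 ⟧ * t + ⟦ + 19 ⟧ * t ^ 2 - ⟦ + 4 ⟧ * t ^ 3) * Q₁
        - t ^ 4 * (⟦ + 5 ⟧ - ⟦ + 8 ⟧ * t) * Q₂ * R
    solved-form {t} {C} {u} {v} {E} {Q₁} {Q₂} {R} rC r₀ r₁ dE hQ₁ hQ₂ hR =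
      elim (difference hQ₁) (elim (difference hQ₂) (elim dE (elim r₀ (elim r₁ (elim (difference hR) (elim rC
      (solve 8 (λ t C u v E Q₁ Q₂ R →
        let s = con (+ 1) :- con (+ 4) :* t
            z = Q₂ :* (con (+ 2) :* (con (+ 1) :- con (+ 2) :* t))
            P = con (+ 2) :- con (+ 12) :* t :+ con (+ 19) :* t :^ 2 :- con (+ 4) :* t :^ 3
            m = t :^ 4 :* (con (+ 5) :- con (+ 8) :* t)
            -- By the hypotheses on `Q₁` and `Q₂`, 4 w is the inverse of (1 - 2t)(1 - 4t)², the
            -- denominator `den t * disc t` cleared in `δE`; hence the factor 4 t w of that
            -- residual.
            w = Q₁ :* Q₂ in
        t :* E :=
        t :^ 2 :* P :* Q₁ :- m :* Q₂ :* R
          :+ (:- (t :* E :* z) :- m :* Q₂ :* R) :* (Q₁ :* (con (+ 2) :* s :^ 2) :- con (+ 1))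
          :+ (t :^ 2 :* P :* Q₁ :- t :* E) :* (z :- con (+ 1))
          :+ con (+ 4) :* t :* w :* P.δE t E C (con (+ 1)) u v
          :+ con (+ 4) :* t :* w :* P.poly (+ 1 ∷ ⊝ 8 ∷ + 21 ∷ ⊝ 19 ∷ + 4 ∷ []) t :* P.u₀-relation t u v
          :+ con (+ 4) :* t :* w :* P.poly (+ 1 ∷ ⊝ 6 ∷ + 10 ∷ ⊝ 4 ∷ []) t :* P.v₀-relation t u v
          :+ (:- (con (+ 2) :* w :* m)) :* (P.root t C :- R :* s :^ 2)
          :+ (:- (con (+ 8) :* w :* t :^ 5)) :* P.C-relation t C)
        refl t C u v E Q₁ Q₂ R)))))))

    module Solution (t C : Carrier) (rC : C-relation t C ≈ 𝟎) (u v e g b U V E G B : ℕ → Carrier)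
      (system : System t u v e g b U V E G B) where

      open System system

      power : ℕ → Carrier
      power zero    = ⟦ + 1 ⟧
      power (suc p) = C * power p

      ΔU Δg Δe Δb ΔE ΔB : ℕ → Carrier
      ΔU p = δU t (U p) C (power p) (u p) (v p)
      Δg p = δg t (g p) C (power p) (u p) (v p)
      Δe p = δe t (e p) C (power p) (u p) (v p)
      Δb p = δb t (b p) C (power p) (u p) (v p)
      ΔE p = δE t (E p) C (power p) (u p) (v p)
      ΔB p = δB t (B p) C (power p) (u p) (v p)

      Δe-step : ∀ p → Δe p ≈ t * Δb p + Δg p
      Δe-step p = δe-step rC (e-rel p)

      Δb-step : ∀ p → Δb p ≈ Δe p + t * Δb (suc p)
      Δb-step p = δb-step rC (u-rel p) (v-rel p) (b-rel p)

      Δg-base : Δg 0 ≈ t * (Δe 0 + Δg 0)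
      Δg-base = δg-base rC u₀-rel v₀-rel g₀-rel

      Δg-step : ∀ p → Δg (suc p) ≈ Δg p + t * (Δe (suc p) - Δe p + Δg (suc p))
      Δg-step p = δg-step rC (u-rel p) (v-rel p) (g-rel p)

      ΔU-base : ΔU 0 ≈ t * (ΔU 0 + ΔU 1)
      ΔU-base = δU-base rC u₀-rel v₀-rel (u-rel 0) (v-rel 0) U₀-rel

      ΔU-step : ∀ p → ΔU (suc p) ≈ ΔU p + t * ΔU (suc (suc p))
      ΔU-step p = δU-step rC (u-rel p) (v-rel p) (u-rel (suc p)) (v-rel (suc p)) (U-rel p)

      ΔB-step : ∀ p → ΔB p ≈ ΔE p + t * ΔB (suc p)
      ΔB-step p = δB-step rC (u-rel p) (v-rel p) (B-rel p)

      ΔE-step : (∀ p → ΔU p ≈ 𝟎) → (∀ p → Δg p ≈ 𝟎) → (∀ p → Δe p ≈ 𝟎) →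
        ∀ p → ΔE p ≈ t * ΔB p + t * ΔE (suc p)
      ΔE-step U≈0 g≈0 e≈0 p = δE-step rC (u-rel p) (v-rel p) (U≈0 p) (U≈0 (suc p)) (g≈0 p) (e≈0 p) (E-rel p)

      closed-form : ΔE 0 ≈ 𝟎 → ∀ Q₁ Q₂ R →
        Q₁ * (⟦ + 2 ⟧ * (⟦ + 1 ⟧ - ⟦ + 4 ⟧ * t) ^ 2) ≈ ⟦ + 1 ⟧ →
        Q₂ * (⟦ + 2 ⟧ * (⟦ + 1 ⟧ - ⟦ + 2 ⟧ * t)) ≈ ⟦ + 1 ⟧ →
        root t C ≈ R * (⟦ + 1 ⟧ - ⟦ + 4 ⟧ * t) ^ 2 →
        t * E 0 ≈ t ^ 2 * (⟦ + 2 ⟧ - ⟦ + 12 ⟧ * t + ⟦ + 19 ⟧ * t ^ 2 - ⟦ + 4 ⟧ * t ^ 3) * Q₁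
          - t ^ 4 * (⟦ + 5 ⟧ - ⟦ + 8 ⟧ * t) * Q₂ * R
      closed-form ΔE₀ Q₁ Q₂ R = solved-form rC u₀-rel v₀-rel ΔE₀

-- From counts to series, vanishing of the residuals, and the choice of square root.

module GeneratingFunction where

  open Codes
  open Counting
  open PowerSeries
  open Elimination
  open import Data.Nat using (ℕ; zero; suc; _<_)
  import Data.Nat as ℕ
  import Data.Nat.Properties as ℕₚ
  open import Data.Nat.Induction using (<-rec)
  open import Data.Integer using (+_)
  open import Data.Rational using (0ℚ; 1ℚ; ½) renaming (_+_ to _+q_; _*_ to _*q_; _-_ to _-q_)
  import Data.Rational.Properties as ℚₚ
  open import Data.Product using (_×_; _,_; proj₁; proj₂)
  open import Relation.Binary.PropositionalEquality using (_≡_; refl; sym; trans; cong; cong₂; module ≡-Reasoning)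

  open Kernel seriesACR ℤ→Series hiding (_-_)

  int-+ℕ : ∀ a b → int (+ (a ℕ.+ b)) ≡ int (+ a) +q int (+ b)
  int-+ℕ a b = int-+ (+ a) (+ b)

  cst-zero : ∀ n → cst (+ 0) n ≡ 0ℚ
  cst-zero zero    = refl
  cst-zero (suc n) = refl

  vanishes : ∀ f → (∀ n → f n ≡ 0ℚ) → f ≈ₛ cst (+ 0)
  vanishes f h n = trans (h n) (sym (cst-zero n))

  ∑-count : ∀ p (f : ℕ → ℕ → ℕ) n → ∑ p (λ x → fromCount (f x)) n ≡ int (+ sumBelow p (λ x → f x n))
  ∑-count zero    f n = cst-zero n
  ∑-count (suc p) f n = trans (cong (int (+ f p n) +q_) (∑-count p f n)) (sym (int-+ℕ (f p n) _))

  one-count : ∀ n → cst (+ 1) n ≡ int (+ isZero n)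
  one-count zero    = refl
  one-count (suc n) = refl

  X-shift : ∀ f g → g 0 ≡ 0ℚ → (∀ n → g (suc n) ≡ f n) → g ≈ₛ X ⊗ f
  X-shift f g g₀ gₛ zero    = trans g₀ (sym (X-⊗-zero f))
  X-shift f g g₀ gₛ (suc n) = trans (gₛ n) (sym (X-⊗-suc f n))

  code code⁺ : Phase → Bound → ℕ → Series
  code  φ β p = fromCount (#Code φ β p)
  code⁺ φ β p = fromCount (#Code⁺ φ β p)

  drop : Bound → ℕ → Series
  drop β p = fromCount (#Drop β p)

  code⁺-sum : ∀ φ β p → code⁺ φ β p ≈ₛ X ⊗ (code φ β (raise β p) ⊕ ∑ (suc p) (code⁺ φ fixed))
  code⁺-sum φ β p = X-shift (code φ β (raise β p) ⊕ ∑ (suc p) (code⁺ φ fixed)) (code⁺ φ β p) refl λ n →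
    trans (int-+ℕ (#Code φ β (raise β p) n) _)
      (cong (int (+ #Code φ β (raise β p) n) +q_) (sym (∑-count (suc p) (#Code⁺ φ fixed) n)))

  drop-sum : ∀ β p → drop β p ≈ₛ code falling β p ⊕ X ⊗ drop β (suc p)
  drop-sum β p zero    = sym (trans (cong (0ℚ +q_) (X-⊗-zero (drop β (suc p)))) refl)
  drop-sum β p (suc n) = trans (int-+ℕ (#Code falling β p (suc n)) _)
    (cong (int (+ #Code falling β p (suc n)) +q_) (sym (X-⊗-suc (drop β (suc p)) n)))

  code-sum : ∀ φ β p f → (∀ n → f n ≡ int (+ (#Left φ β p n ℕ.+ sumBelow (turnRange φ p) (λ x → #Code rising β x n)))) →
    code φ β p ≈ₛ X ⊗ (cst (+ 1) ⊕ f) ⊕ code⁺ φ β p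
  code-sum φ β p f h zero = sym (trans (cong (_+q 0ℚ) (X-⊗-zero (cst (+ 1) ⊕ f))) refl)
  code-sum φ β p f h (suc n) = begin
    int (+ (isZero n ℕ.+ (L ℕ.+ (T ℕ.+ H))))               ≡⟨ cong (λ m → int (+ (isZero n ℕ.+ m))) (ℕₚ.+-assoc L T H) ⟨
    int (+ (isZero n ℕ.+ (L ℕ.+ T ℕ.+ H)))                 ≡⟨ cong (λ m → int (+ m)) (ℕₚ.+-assoc (isZero n) (L ℕ.+ T) H) ⟨
    int (+ (isZero n ℕ.+ (L ℕ.+ T) ℕ.+ H))                 ≡⟨ int-+ℕ (isZero n ℕ.+ (L ℕ.+ T)) H ⟩
    int (+ (isZero n ℕ.+ (L ℕ.+ T))) +q int (+ H)          ≡⟨ cong (_+q int (+ H)) (int-+ℕ (isZero n) (L ℕ.+ T)) ⟩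
    int (+ isZero n) +q int (+ (L ℕ.+ T)) +q int (+ H)     ≡⟨ cong (_+q int (+ H)) (cong₂ _+q_ (one-count n) (h n)) ⟨
    (cst (+ 1) ⊕ f) n +q int (+ H)                         ≡⟨ cong (_+q int (+ H)) (X-⊗-suc (cst (+ 1) ⊕ f) n) ⟨
    (X ⊗ (cst (+ 1) ⊕ f)) (suc n) +q int (+ H)             ∎
    where
    open ≡-Reasoning
    L = #Left φ β p n
    T = sumBelow (turnRange φ p) (λ x → #Code rising β x n)
    H = #Code⁺ φ β p (suc n)

  rising-sum : ∀ β p → code rising β p ≈ₛ X ⊗ (cst (+ 1) ⊕ ∑ (suc p) (code rising β)) ⊕ code⁺ rising β p
  rising-sum β p = code-sum rising β p (∑ (suc p) (code rising β)) (∑-count (suc p) (#Code rising β))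

  falling-sum : ∀ β p → code falling β p ≈ₛ X ⊗ (cst (+ 1) ⊕ (drop β p ⊕ ∑ p (code rising β))) ⊕ code⁺ falling β p
  falling-sum β p = code-sum falling β p (drop β p ⊕ ∑ p (code rising β)) λ n →
    trans (cong (int (+ #Drop β p n) +q_) (∑-count p (#Code rising β) n)) (sym (int-+ℕ (#Drop β p n) _))

  system : System X
    (code rising fixed) (code⁺ rising fixed) (code falling fixed) (code⁺ falling fixed) (drop fixed)
    (code rising level) (code⁺ rising level) (code falling level) (code⁺ falling level) (drop level)
  system = record
    { u-sum = rising-sum fixed ; v-sum = code⁺-sum rising fixed
    ; e-sum = falling-sum fixed ; g-sum = code⁺-sum falling fixed ; b-sum = drop-sum fixed
    ; U-sum = rising-sum level ; V-sum = code⁺-sum rising level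
    ; E-sum = falling-sum level ; G-sum = code⁺-sum falling level ; B-sum = drop-sum level }

  X-vanish : ∀ f n → (∀ m → m < n → f m ≡ 0ℚ) → (X ⊗ f) n ≡ 0ℚ
  X-vanish f zero    h = X-⊗-zero f
  X-vanish f (suc n) h = trans (X-⊗-suc f n) (h n ℕₚ.≤-refl)

  X-cancel : ∀ f → X ⊗ f ≈ₛ cst (+ 0) → f ≈ₛ cst (+ 0)
  X-cancel f h = vanishes f λ n → trans (sym (X-⊗-suc f n)) (h (suc n))

  sum₀ : ∀ {a b} → a ≡ 0ℚ → b ≡ 0ℚ → a +q b ≡ 0ℚ
  sum₀ refl refl = refl

  sub₀ : ∀ {a b} → a ≡ 0ℚ → b ≡ 0ℚ → a -q b ≡ 0ℚ
  sub₀ refl refl = refl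

  -- The Δ's satisfy a homogeneous system that determines each coefficient from earlier ones, so they vanish.
  module Vanishing (C : Series) (rC : C-relation X C ≈ₛ cst (+ 0)) where

    open Solution X C rC
      (code rising fixed) (code⁺ rising fixed) (code falling fixed) (code⁺ falling fixed) (drop fixed)
      (code rising level) (code⁺ rising level) (code falling level) (code⁺ falling level) (drop level)
      system public

    -- Stated for all p at once: coefficient n at p refers to larger p, but only in coefficients
    -- below n.
    FixedZero LevelZero : ℕ → Set
    FixedZero n = ∀ p → Δg p n ≡ 0ℚ × Δe p n ≡ 0ℚ × Δb p n ≡ 0ℚ
    LevelZero n = ∀ p → ΔE p n ≡ 0ℚ × ΔB p n ≡ 0ℚ

    module _ {n} (below : ∀ {m} → m < n → FixedZero m) where
      -- `Δg p` enters `Δg (suc p)` at the same coefficient, which calls for an inner induction on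
      -- p; `Δe` and `Δb` then follow in this order.
      g-zero : ∀ p → Δg p n ≡ 0ℚ
      g-zero zero = trans (Δg-base n)
        (X-vanish (Δe 0 ⊕ Δg 0) n λ m m<n → let g , e , _ = below m<n 0 in sum₀ e g)
      g-zero (suc p) = trans (Δg-step p n)
        (sum₀ (g-zero p) (X-vanish (Δe (suc p) ⊖ Δe p ⊕ Δg (suc p)) n λ m m<n →
          let _ , e , _ = below m<n p ; g , e′ , _ = below m<n (suc p) in sum₀ (sub₀ e′ e) g))

      e-zero : ∀ p → Δe p n ≡ 0ℚ
      e-zero p = trans (Δe-step p n) (sum₀ (X-vanish (Δb p) n λ m m<n → proj₂ (proj₂ (below m<n p))) (g-zero p))

      b-zero : ∀ p → Δb p n ≡ 0ℚ
      b-zero p = trans (Δb-step p n)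
        (sum₀ (e-zero p) (X-vanish (Δb (suc p)) n λ m m<n → proj₂ (proj₂ (below m<n (suc p)))))

    fixed-zero : ∀ n → FixedZero n
    fixed-zero = <-rec FixedZero λ n below p → g-zero below p , e-zero below p , b-zero below p

    U-zero : ∀ n p → ΔU p n ≡ 0ℚ
    U-zero = <-rec (λ n → ∀ p → ΔU p n ≡ 0ℚ) λ n → from-below {n}
      where
      from-below : ∀ {n} → (∀ {m} → m < n → ∀ p → ΔU p m ≡ 0ℚ) → ∀ p → ΔU p n ≡ 0ℚ
      from-below {n} below zero = trans (ΔU-base n)
        (X-vanish (ΔU 0 ⊕ ΔU 1) n λ m m<n → sum₀ (below m<n 0) (below m<n 1))
      from-below {n} below (suc p) = trans (ΔU-step p n)
        (sum₀ (from-below below p) (X-vanish (ΔU (suc (suc p))) n λ m m<n → below m<n (suc (suc p))))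

    level-zero : ∀ n → LevelZero n
    level-zero = <-rec LevelZero λ n below p → E-zero below p , B-zero below p
      where
      module _ {n} (below : ∀ {m} → m < n → LevelZero m) where
        -- Once the residuals of U, g and e vanish, every remaining term carries a factor X, and the
        -- induction on the coefficient settles all p together.
        E-zero : ∀ p → ΔE p n ≡ 0ℚ
        E-zero p = trans
          (ΔE-step (λ p → vanishes (ΔU p) (λ m → U-zero m p)) (λ p → vanishes (Δg p) (λ m → proj₁ (fixed-zero m p)))
            (λ p → vanishes (Δe p) (λ m → proj₁ (proj₂ (fixed-zero m p)))) p n)
          (sum₀ (X-vanish (ΔB p) n λ m m<n → proj₂ (below m<n p))
            (X-vanish (ΔE (suc p)) n λ m m<n → proj₁ (below m<n (suc p))))

        B-zero : ∀ p → ΔB p n ≡ 0ℚ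
        B-zero p = trans (ΔB-step p n)
          (sum₀ (E-zero p) (X-vanish (ΔB (suc p)) n λ m m<n → proj₂ (below m<n (suc p))))

    ΔE₀ : ΔE 0 ≈ₛ cst (+ 0)
    ΔE₀ = vanishes (ΔE 0) λ n → proj₁ (level-zero n 0)

  generating-function : fromCount #ascending ≈ₛ X ⊗ code falling level 0
  generating-function = X-shift (code falling level 0) (fromCount #ascending) refl λ n → refl

  half : Series
  half = const ½

  2half : cst (+ 2) ⊗ half ≈ₛ cst (+ 1)
  2half zero    = refl
  2half (suc n) = const-⊗ (int (+ 2)) half (suc n)

  module Catalan (R : Series) (R₀ : R 0 ≡ 1ℚ) (R² : R ⊗ R ⊗ (cst (+ 1) ⊖ cst (+ 4) ⊗ X) ^ₛ 3 ≈ₛ cst (+ 1)) where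

    √ : Series
    √ = R ⊗ (cst (+ 1) ⊖ cst (+ 4) ⊗ X) ^ₛ 2

    -- The Catalan series (1 - √) / (2 X); `tail` divides by X because the constant term of the
    -- numerator is 0.
    catalan : Series
    catalan = tail (half ⊗ (cst (+ 1) ⊖ √))

    X-catalan : X ⊗ catalan ≈ₛ half ⊗ (cst (+ 1) ⊖ √)
    X-catalan n = sym (X-shift catalan (half ⊗ (cst (+ 1) ⊖ √)) start (λ _ → refl) n)
      where
      start : ½ *q (1ℚ -q R 0 *q 1ℚ) ≡ 0ℚ
      -- R 0 = 1 selects the square root with constant term 1; the opposite sign would leave a
      -- numerator not divisible by X.
      start = cong (λ r → ½ *q (1ℚ -q r *q 1ℚ)) R₀

    catalan-relation : C-relation X catalan ≈ₛ cst (+ 0)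
    catalan-relation = X-cancel (C-relation X catalan)
      (t*C-relation X half √ catalan 2half X-catalan (root-square X R R²))

    root-catalan : root X catalan ≈ₛ √
    root-catalan = root≈ X half √ catalan 2half X-catalan

open import Data.Nat using (ℕ)
open import Data.Integer using (+_)
open import Data.Rational using (1ℚ)
open import Data.Product using (Σ; _×_; _,_)
open import Relation.Binary.PropositionalEquality using (_≡_; trans)
open Counting using (#ascending; countsAscending)
open GeneratingFunction

theorem5 : Σ (ℕ → ℕ) λ a → CountsAscending a ×
    (∀ (Q₁ Q₂ R : Series) →
    Q₁ ⊗ (cst (+ 2) ⊗ (cst (+ 1) ⊖ cst (+ 4) ⊗ X) ^ₛ 2) ≈ₛ cst (+ 1) →
    Q₂ ⊗ (cst (+ 2) ⊗ (cst (+ 1) ⊖ cst (+ 2) ⊗ X)) ≈ₛ cst (+ 1) →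
    R 0 ≡ 1ℚ →
    R ⊗ R ⊗ (cst (+ 1) ⊖ cst (+ 4) ⊗ X) ^ₛ 3 ≈ₛ cst (+ 1) →
    fromCount a ≈ₛ
    X ^ₛ 2 ⊗ (cst (+ 2) ⊖ cst (+ 12) ⊗ X ⊕ cst (+ 19) ⊗ X ^ₛ 2 ⊖ cst (+ 4) ⊗ X ^ₛ 3) ⊗ Q₁
    ⊖ X ^ₛ 4 ⊗ (cst (+ 5) ⊖ cst (+ 8) ⊗ X) ⊗ Q₂ ⊗ R)
theorem5 = #ascending , countsAscending , λ Q₁ Q₂ R hQ₁ hQ₂ R₀ R² n →
  let module C = Catalan R R₀ R²
      module V = Vanishing C.catalan C.catalan-relation
  in trans (generating-function n) (V.closed-form V.ΔE₀ Q₁ Q₂ R hQ₁ hQ₂ C.root-catalan n)
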